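{- Let $n\ge 1$. The set $$\mathcal{D}_n=\big\{\Delta_{C(\alpha)} : \alpha\in\{0,1\}^n \text{ a ballot sequence}\big\}$$ is a basis of $EQH_n$, and (its image in the quotient is) a basis of $EQC_n=R_n/I_n$.
   Context: Let $R_n=\mathbb{Q}[\theta_1,\dots,\theta_n]$ be the polynomial ring in anticommuting variables over $\mathbb{Q}$ (exterior algebra): $\theta_i\theta_j=-\theta_j\theta_i$ for $i\ne j$, $\theta_i^2=0$. For $A=\{a_1<\cdots<a_r\}\subseteq[n]$ put $\theta_A=\theta_{a_1}\cdots\theta_{a_r}$, and $F_{1^r}=\sum_{A\subseteq[n],|A|=r}\theta_A$. Let $I_n$ be the ideal of $R_n$ generated by $F_{1^r}$, $1\le r\le n$, and $EQC_n=R_n/I_n$. Operators $\partial_{\theta_i}$ on $R_n$: $\partial_{\theta_i}(\theta_A)=(-1)^{\#\{j\in A: j<i\}}\theta_{A\setminus\{i\}}$ if $i\in A$, and $0$ otherwise. The inner product on $R_n$ is $\langle p,q\rangle=\overline{p(\partial_{\theta_1},\dots,\partial_{\theta_n})}\,q(\theta_1,\dots,\theta_n)|_{\theta_1=\cdots=\theta_n=0}$, where the bar reverses the order of the factors in every monomial; the monomials $\theta_A$ are an orthonormal basis for it. Define $EQH_n=\{q\in R_n:\langle p,q\rangle=0\text{ for all }p\in I_n\}$. A ballot sequence is $\alpha=(a_1,\dots,a_n)\in\{0,1\}^n$ with $\sum_{i=1}^r a_i\le r/2$ for all $1\le r\le n$. Given a ballot sequence $\alpha$, replace each $0$ by an open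 parenthesis and each $1$ by a closing parenthesis and perform the usual maximal matching of parentheses (every closing parenthesis gets matched; some open ones may remain unmatched). Let $C(\alpha)=((i_1,j_1),\dots,(i_k,j_k))$ be the list of matched pairs of positions ($i_r<j_r$, $i_r$ the open and $j_r$ the closing parenthesis), ordered so that $j_1<j_2<\cdots<j_k$. E.g. $\alpha=0010001101$ gives $C(\alpha)=((2,3),(6,7),(5,8),(9,10))$. Define $\Delta_{C(\alpha)}=(\theta_{j_1}-\theta_{i_1})(\theta_{j_2}-\theta_{i_2})\cdots(\theta_{j_k}-\theta_{i_k})$, with $\Delta_{C(\alpha)}=1$ if $k=0$. -}

module Defs where

open import Algebra.Bundles using (Ring; AbelianGroup)
open import Algebra.Definitions.RawMonoid using (sum)
open import Algebra.Module.Bundles using (LeftModule)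
open import Algebra.Module.Structures using (IsLeftModule)
import Algebra.Construct.Pointwise as Pointwise
open import Data.Bool.Base using (if_then_else_)
open import Data.Fin.Base using (Fin; zero; suc; toℕ)
open import Data.Fin.Patterns using (0F; 1F)
import Data.Fin.Properties as Fin
open import Data.Fin.Subset
  using (Subset; inside; outside; ⊥; ⁅_⁆; _∩_; _∪_; _-_; ∣_∣)
open import Data.Fin.Subset.Properties using (_∈?_; nonempty?)
open import Data.List.Base as List
  using (List; []; _∷_; map; filter; length; foldr; reverse)
open import Data.Nat.Base as ℕ using (ℕ; zero; suc)
open import Data.Nat.ListAction using () renaming (sum to ℕ-sum)
import Data.Nat.Properties as ℕ
open import Data.Product.Base using (Σ; ∃; _×_; _,_)
open import Data.Rational.Base using (ℚ; 0ℚ; 1ℚ; _+_; _*_; -_)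
import Data.Rational.Properties as ℚ
open import Data.Rational.Solver using (module +-*-Solver)
open import Data.Vec.Base as Vec using (Vec; []; _∷_)
open import Data.Vec.Functional as Vector using (Vector)
import Data.Vec.Properties as Vec
import Data.Bool.Properties as Bool
open import Function.Base using (_∘_)
open import Function.Definitions using (Injective)
open import Level using (Level; _⊔_; 0ℓ)
open import Relation.Binary.Bundles using (Setoid)
import Relation.Binary.Construct.On as On
open import Relation.Binary.PropositionalEquality
  using (_≡_; refl; sym; trans; cong; cong₂)
open import Relation.Nullary.Decidable using (does)
open import Relation.Unary using (Pred; _∈_)

------------------------------------------------------------------------
-- Bases

module _ {r ℓr m ℓm : Level} {K : Ring r ℓr} (M : LeftModule K m ℓm) where
  open Ring K using (Carrier; _≈_; 0#)
  open LeftModule M using (Carrierᴹ; _≈ᴹ_; _*ₗ_; 0ᴹ; +ᴹ-rawMonoid)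

  linearCombination : ∀ {k} → Vector Carrier k → Vector Carrierᴹ k → Carrierᴹ
  linearCombination c v = sum +ᴹ-rawMonoid (Vector.zipWith _*ₗ_ c v)

  -- The elements b i, for i in the setoid S, form a basis of the subspace W
  -- of M.  Only finitely many distinct elements of S enter a linear
  -- combination.
  record IsBasisOf {w s ℓs : Level} (W : Pred Carrierᴹ w) (S : Setoid s ℓs)
                   (b : Setoid.Carrier S → Carrierᴹ)
                   : Set (r ⊔ ℓr ⊔ m ⊔ ℓm ⊔ w ⊔ s ⊔ ℓs) where
    private module S = Setoid S
    field
      contained   : ∀ i → b i ∈ W
      independent : ∀ {k} (x : Fin k → S.Carrier) → Injective _≡_ S._≈_ x →
                    ∀ (c : Vector Carrier k) →
                    linearCombination c (b ∘ x) ≈ᴹ 0ᴹ → ∀ i → c i ≈ 0#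
      spanning    : ∀ v → v ∈ W →
                    ∃ λ k → Σ (Fin k → S.Carrier) λ x → Σ (Vector Carrier k) λ c →
                    v ≈ᴹ linearCombination c (b ∘ x)

------------------------------------------------------------------------
-- The exterior algebra

-- p : R n stands for Σ_A (p A) θ_A.  Equality is pointwise.
R : ℕ → Set
R n = Subset n → ℚ

infix 4 _≈_
_≈_ : ∀ {n} → R n → R n → Set
p ≈ q = ∀ A → p A ≡ q A

∑ : ∀ {n} → (Subset n → ℚ) → ℚ
∑ {zero}  f = f []
∑ {suc n} f = ∑ (f ∘ (outside ∷_)) + ∑ (f ∘ (inside ∷_))

infixl 6 _⊕_ _⊖_
infixr 7 _•_ _⊛_

_⊕_ _⊖_ : ∀ {n} → R n → R n → R n
(p ⊕ q) A = p A + q A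
(p ⊖ q) A = p A + - q A

⊖_ : ∀ {n} → R n → R n
(⊖ p) A = - p A

_•_ : ∀ {n} → ℚ → R n → R n
(c • p) A = c * p A

𝟎 : ∀ {n} → R n
𝟎 A = 0ℚ

θ[_] : ∀ {n} → Subset n → R n
θ[ A ] B = if does (Vec.≡-dec Bool._≟_ A B) then 1ℚ else 0ℚ

𝟏 : ∀ {n} → R n
𝟏 = θ[ ⊥ ]

θ : ∀ {n} → Fin n → R n
θ i = θ[ ⁅ i ⁆ ]

-- The linear map sending θ[ A ] to f A.
extend : ∀ {n m} → (Subset n → R m) → R n → R m
extend f p C = ∑ λ A → p A * f A C

-1^_ : ℕ → ℚ
-1^ zero  = 1ℚ
-1^ suc k = - (-1^ k)

-- In increasing order.
elements : ∀ {n} → Subset n → List (Fin n)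
elements []            = []
elements (inside  ∷ A) = zero ∷ map suc (elements A)
elements (outside ∷ A) = map suc (elements A)

#below : ∀ {n} → Fin n → Subset n → ℕ
#below i A = length (filter (Fin._<? i) (elements A))

inversions : ∀ {n} → Subset n → Subset n → ℕ
inversions A B = ℕ-sum (map (λ a → #below a B) (elements A))

-- θ_A θ_B vanishes if A and B meet; otherwise sorting the word θ_A θ_B into
-- increasing order takes one transposition for every a ∈ A, b ∈ B with b < a.
monomialProduct : ∀ {n} → Subset n → Subset n → R n
monomialProduct A B =
  if does (nonempty? (A ∩ B)) then 𝟎 else (-1^ inversions A B) • θ[ A ∪ B ]

_⊛_ : ∀ {n} → R n → R n → R n
p ⊛ q = extend (λ A → extend (monomialProduct A) q) p

R-module : ℕ → LeftModule ℚ.+-*-ring 0ℓ 0ℓ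
R-module n = record
  { _≈ᴹ_ = _≈_ {n} ; _+ᴹ_ = _⊕_ ; _*ₗ_ = _•_ ; 0ᴹ = 𝟎 ; -ᴹ_ = ⊖_
  ; isLeftModule = record
    { isLeftSemimodule = record
      { +ᴹ-isCommutativeMonoid = isCommutativeMonoid
      ; isPreleftSemimodule = record
        { *ₗ-cong      = λ c≡d p≈q A → cong₂ _*_ c≡d (p≈q A)
        ; *ₗ-zeroˡ     = λ p A → ℚ.*-zeroˡ (p A)
        ; *ₗ-distribʳ  = λ p c d A → ℚ.*-distribʳ-+ (p A) c d
        ; *ₗ-identityˡ = λ p A → ℚ.*-identityˡ (p A)
        ; *ₗ-assoc     = λ c d p A → ℚ.*-assoc c d (p A)
        ; *ₗ-zeroʳ     = λ c A → ℚ.*-zeroʳ c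
        ; *ₗ-distribˡ  = λ c p q A → ℚ.*-distribˡ-+ c (p A) (q A)
        }
      }
    ; -ᴹ‿cong    = ⁻¹-cong
    ; -ᴹ‿inverse = inverse
    }
  }
  where
  open AbelianGroup (Pointwise.abelianGroup (Subset n) ℚ.+-0-abelianGroup)
    using (isCommutativeMonoid; ⁻¹-cong; inverse)

------------------------------------------------------------------------
-- The ideal and the quotient

-- F_{1^r}
F : ∀ {n} → ℕ → R n
F r A = if does (∣ A ∣ ℕ.≟ r) then 1ℚ else 0ℚ

-- The two-sided ideal I n of the ℚ-algebra R n, as the least linear subspace
-- containing the generators and closed under multiplication by R n on either
-- side.
data I (n : ℕ) : Pred (R n) 0ℓ where
  generator : ∀ {r} → 1 ℕ.≤ r → r ℕ.≤ n → F r ∈ I n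
  resp      : ∀ {p q} → p ≈ q → p ∈ I n → q ∈ I n
  zero      : 𝟎 ∈ I n
  add       : ∀ {p q} → p ∈ I n → q ∈ I n → p ⊕ q ∈ I n
  scale     : ∀ c {p} → p ∈ I n → c • p ∈ I n
  mulˡ      : ∀ f {p} → p ∈ I n → f ⊛ p ∈ I n
  mulʳ      : ∀ f {p} → p ∈ I n → p ⊛ f ∈ I n

infix 4 _≈_[mod-I]
_≈_[mod-I] : ∀ {n} → R n → R n → Set
_≈_[mod-I] {n} p q = p ⊖ q ∈ I n

EQC : ℕ → LeftModule ℚ.+-*-ring 0ℓ 0ℓ
EQC n = record
  { _≈ᴹ_ = _≈_[mod-I] {n} ; _+ᴹ_ = _⊕_ ; _*ₗ_ = _•_ ; 0ᴹ = 𝟎 ; -ᴹ_ = ⊖_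
  ; isLeftModule = record
    { isLeftSemimodule = record
      { +ᴹ-isCommutativeMonoid = record
        { isMonoid = record
          { isSemigroup = record
            { isMagma = record
              { isEquivalence = record
                { refl  = λ {p} → lift {p} λ A → refl
                ; sym   = λ {p} {q} → symm {p} {q}
                ; trans = λ {p} {q} {s} → transit {p} {q} {s}
                }
              ; ∙-cong = λ {p} {p′} {q} {q′} → ⊕-cong {p} {p′} {q} {q′}
              }
            ; assoc = λ p q s → lift (M.+ᴹ-assoc p q s)
            }
          ; identity = (λ p → lift (M.+ᴹ-identityˡ p))
                     , (λ p → lift (M.+ᴹ-identityʳ p))
          }
        ; comm = λ p q → lift (M.+ᴹ-comm p q)
        }
      ; isPreleftSemimodule = record
        { *ₗ-cong      = λ {c} {d} {p} {q} → •-cong {c} {d} {p} {q}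
        ; *ₗ-zeroˡ     = λ p → lift (M.*ₗ-zeroˡ p)
        ; *ₗ-distribʳ  = λ p c d → lift (M.*ₗ-distribʳ p c d)
        ; *ₗ-identityˡ = λ p → lift (M.*ₗ-identityˡ p)
        ; *ₗ-assoc     = λ c d p → lift (M.*ₗ-assoc c d p)
        ; *ₗ-zeroʳ     = λ c → lift (M.*ₗ-zeroʳ c)
        ; *ₗ-distribˡ  = λ c p q → lift (M.*ₗ-distribˡ c p q)
        }
      }
    ; -ᴹ‿cong    = λ {p} {q} → ⊖-cong {p} {q}
    ; -ᴹ‿inverse = (λ p → lift (M.-ᴹ‿inverseˡ p))
                 , (λ p → lift (M.-ᴹ‿inverseʳ p))
    }
  }
  where
  module M = LeftModule (R-module n)
  open +-*-Solver using (solve; _:+_; _:*_; :-_; _:=_; con)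

  lift : {p q : R n} → p ≈ q → p ≈ q [mod-I]
  lift {p} {q} p≈q = resp (λ A → sym (trans (cong (_+ - q A) (p≈q A))
                                            (ℚ.+-inverseʳ (q A)))) zero

  symm : {p q : R n} → p ≈ q [mod-I] → q ≈ p [mod-I]
  symm {p} {q} h = resp
    (λ A → solve 2 (λ x y → con (- 1ℚ) :* (x :+ :- y) := y :+ :- x) refl (p A) (q A))
    (scale (- 1ℚ) h)

  transit : {p q s : R n} → p ≈ q [mod-I] → q ≈ s [mod-I] → p ≈ s [mod-I]
  transit {p} {q} {s} h k = resp
    (λ A → solve 3 (λ x y z → (x :+ :- y) :+ (y :+ :- z) := x :+ :- z) refl
             (p A) (q A) (s A))
    (add h k)

  ⊕-cong : {p p′ q q′ : R n} → p ≈ p′ [mod-I] → q ≈ q′ [mod-I] →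
           p ⊕ q ≈ p′ ⊕ q′ [mod-I]
  ⊕-cong {p} {p′} {q} {q′} h k = resp
    (λ A → solve 4 (λ x x′ y y′ → (x :+ :- x′) :+ (y :+ :- y′)
                                  := (x :+ y) :+ :- (x′ :+ y′)) refl
             (p A) (p′ A) (q A) (q′ A))
    (add h k)

  •-cong : {c d : ℚ} {p q : R n} → c ≡ d → p ≈ q [mod-I] → c • p ≈ d • q [mod-I]
  •-cong {c} {_} {p} {q} refl h = resp
    (λ A → solve 3 (λ a x y → a :* (x :+ :- y) := a :* x :+ :- (a :* y)) refl
             c (p A) (q A))
    (scale c h)

  ⊖-cong : {p q : R n} → p ≈ q [mod-I] → ⊖ p ≈ ⊖ q [mod-I]
  ⊖-cong {p} {q} h = resp
    (λ A → solve 2 (λ x y → con (- 1ℚ) :* (x :+ :- y) := :- x :+ :- (:- y)) refl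
             (p A) (q A))
    (scale (- 1ℚ) h)

------------------------------------------------------------------------
-- The inner product and the harmonics

∂ : ∀ {n} → Fin n → R n → R n
∂ i = extend λ A →
  if does (i ∈? A) then (-1^ #below i A) • θ[ A - i ] else 𝟎

-- The operator ∂_{i₁} ∂_{i₂} ⋯ ∂_{iₖ}, the rightmost factor acting first.
∂-word : ∀ {n} → List (Fin n) → R n → R n
∂-word w q = foldr ∂ q w

-- Evaluating an element of R n at θ₁ = ⋯ = θₙ = 0 takes its coefficient at ⊥.
⟨_,_⟩ : ∀ {n} → R n → R n → ℚ
⟨ p , q ⟩ = ∑ λ A → p A * ∂-word (reverse (elements A)) q ⊥

EQH : ∀ n → Pred (R n) 0ℓ
EQH n q = ∀ p → p ∈ I n → ⟨ p , q ⟩ ≡ 0ℚ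

------------------------------------------------------------------------
-- Ballot sequences and the elements Δ

partialSum : ∀ {n} → ℕ → Vec (Fin 2) n → ℕ
partialSum r α = ℕ-sum (List.take r (map toℕ (Vec.toList α)))

Ballot : ∀ {n} → Pred (Vec (Fin 2) n) 0ℓ
Ballot {n} α = ∀ r → 1 ℕ.≤ r → r ℕ.≤ n → 2 ℕ.* partialSum r α ℕ.≤ r

-- The first argument is the stack of positions of the currently unmatched
-- opening parentheses, the innermost one on top.
match : ∀ {n} → List (Fin n) → List (Fin n × Fin 2) → List (Fin n × Fin n)
match open′    []             = []
match open′    ((i , 0F) ∷ w) = match (i ∷ open′) w
match []       ((j , 1F) ∷ w) = match [] w
match (i ∷ is) ((j , 1F) ∷ w) = (i , j) ∷ match is w

-- The pairs come out in the order in which they are closed.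
C : ∀ {n} → Vec (Fin 2) n → List (Fin n × Fin n)
C {n} α = match [] (Vec.toList (Vec.zip (Vec.allFin n) α))

Δ : ∀ {n} → List (Fin n × Fin n) → R n
Δ = foldr (λ (i , j) p → (θ j ⊖ θ i) ⊛ p) 𝟏

ΔC : ∀ {n} → ∃ (Ballot {n}) → R n
ΔC (α , _) = Δ (C α)

-- The set { Δ_{C(α)} : α a ballot sequence }, as the image of ΔC: two ballot
-- sequences name the same element when their ΔC agree in R n.
𝒟 : ℕ → Setoid 0ℓ 0ℓ
𝒟 n = On.setoid (LeftModule.≈ᴹ-setoid (R-module n)) (ΔC {n})

{-# OPTIONS --safe #-}
module Submission where

-- Splitting off the first variable, q = q⁰ + θ₁ q¹, everything becomes recursive.  Let E r be the
-- adjoint of left multiplication by F r.  As F r commutes with everything up to signs, q is in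
-- EQH n iff E r q = 0 for all r ≥ 1 ("harmonic").  The E r with r ≥ 1 are generated by E 1 and E 2,
-- and commuting E 2 past θⱼ − θᵢ leaves a contraction which kills θₗ − θₖ when the pairs do not
-- cross; hence every Δ is harmonic.
--
-- Allow words preceded by h opening parentheses, and let D h α be the corresponding Δ with the
-- variables of those parentheses set to 0.  Then (D h (0α))⁰ = D (h+1) α and D (h+1) (1α) = θ₁ D h α,
-- so a combination of the D h α can be given any coefficients at the ballot words, in a unique
-- way.  On the other hand, if E r q = 0 for all r > h, then the same holds for q⁰ with h + 1 and,
-- if q⁰ = 0, for q¹ with h − 1, so that q is determined by its coefficients at the ballot words.
-- This gives the basis of EQH n.  For the quotient, Gram–Schmidt over ℚ splits every v into an
-- element of I n and a harmonic one, and the two spaces meet in 0 as the inner product is definite.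
open import Data.Bool.Base using (Bool; true; false; if_then_else_)
import Data.Bool.Properties as Bool
open import Data.Fin.Base as Fin using (Fin; zero; suc)
open import Data.Fin.Patterns using (0F; 1F)
import Data.Fin.Properties as Fin
open import Data.Fin.Subset using (Subset; inside; outside; ⊥; _∩_; _∪_; _-_; ∣_∣)
open import Data.Fin.Subset.Properties using (_∈?_; nonempty?; ∣p∣≤n; p─⊥≡p)
open import Data.List.Base as List using (List; []; _∷_; _++_; map; filter; length; lookup; foldr; reverse)
import Data.List.Properties as List
open import Data.List.Relation.Unary.All as All using (All; []; _∷_)
import Data.List.Relation.Unary.All.Properties as All
open import Data.List.Relation.Unary.AllPairs as AllPairs using (AllPairs; []; _∷_)
import Data.List.Relation.Unary.AllPairs.Properties as AllPairs
open import Data.Nat.Base as ℕ using (ℕ; zero; suc; _≥_; s≤s; z≤n)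
open import Data.Nat.ListAction using () renaming (sum to ℕ-sum)
import Data.Nat.Properties as ℕ
open import Data.Product.Base using (Σ; ∃; _×_; _,_; proj₁; proj₂; map₁)
open import Data.Rational.Base
  using (ℚ; 0ℚ; 1ℚ; _+_; _*_; -_; 1/_; _≤_; NonZero; NonNegative; ≢-nonZero; nonNegative; nonPositive)
import Data.Rational.Properties as ℚ
open import Data.Rational.Solver using (module +-*-Solver)
open import Data.Sum.Base using (_⊎_; inj₁; inj₂)
open import Data.Unit.Base using (tt)
open import Data.Vec.Base as Vec using (Vec; []; _∷_; there)
open import Data.Vec.Functional using (Vector)
import Data.Vec.Properties as Vec
open import Function.Base using (_∘_; id)
open import Function.Bundles using (mk⇔)
open import Function.Definitions using (Injective)
open import Level using (0ℓ)
open import Relation.Binary.PropositionalEquality hiding (resp)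
open import Relation.Nullary.Decidable using (does; yes; no; does-⇔; dec-true; dec-false)
open import Relation.Nullary.Negation using (contradiction)
open import Relation.Unary using (Pred; U; _∈_)
open import Defs

open +-*-Solver using (solve; _:+_; _:*_; :-_; _:=_; con)
open ≡-Reasoning

-- A suffix of a ballot word need not be ballot, so every induction carries the number `h` of
-- parentheses left open by the removed prefix. The conditions on `q` move in step: an opening costs
-- one degree of control over `E`, a closing regains it, and at `h = 0` the regained condition is
-- `E 0 (q ¹) = 0`, that is `q ¹ = 0`, exactly where no ballot word continues. No dimension is
-- counted. The coefficients at ballot words serve as coordinates twice: a harmonic element is
-- determined by them, and combinations of the `D 0 α` realize all values. Hence a harmonic element
-- equals the combination that interpolates it. Non-crossing matters only for the harmonicity of Δ.
-- `E 2` is the sum of the ∂ⱼ∂ᵢ with i < j, so its commutator with a linear form v is the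
-- contraction by the alternating form Σ_{i<j} (vᵢwⱼ - vⱼwᵢ). For v = θⱼ - θᵢ this covector is
-- supported on the interval [i, j], so it does not see a chord with both ends outside.
-- Characteristic 0 enters through the factors ⌊k/2⌋ + 1, the order of ℚ through definiteness.

infix 8 _⁰ _¹

_⁰ _¹ : ∀ {n} → R (suc n) → R n
p ⁰ = p ∘ (outside ∷_)
p ¹ = p ∘ (inside ∷_)

-- Sums over subsets and the coordinate pairing.

∑-cong : ∀ {n} {f g : R n} → f ≈ g → ∑ f ≡ ∑ g
∑-cong {zero}  f≈g = f≈g []
∑-cong {suc n} f≈g = cong₂ _+_ (∑-cong (f≈g ∘ (outside ∷_))) (∑-cong (f≈g ∘ (inside ∷_)))

∑-+ : ∀ {n} (f g : R n) → ∑ (λ A → f A + g A) ≡ ∑ f + ∑ g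
∑-+ {zero}  f g = refl
∑-+ {suc n} f g = trans (cong₂ _+_ (∑-+ (f ⁰) (g ⁰)) (∑-+ (f ¹) (g ¹)))
  (solve 4 (λ a b c d → (a :+ b) :+ (c :+ d) := (a :+ c) :+ (b :+ d)) refl
    (∑ (f ⁰)) (∑ (g ⁰)) (∑ (f ¹)) (∑ (g ¹)))

∑-* : ∀ {n} c (f : R n) → ∑ (λ A → c * f A) ≡ c * ∑ f
∑-* {zero}  c f = refl
∑-* {suc n} c f = trans (cong₂ _+_ (∑-* c (f ⁰)) (∑-* c (f ¹)))
  (sym (ℚ.*-distribˡ-+ c (∑ (f ⁰)) (∑ (f ¹))))

∑-zero : ∀ {n} → ∑ {n} (λ _ → 0ℚ) ≡ 0ℚ
∑-zero {zero}  = refl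
∑-zero {suc n} = cong₂ _+_ (∑-zero {n}) (∑-zero {n})

∑-≈0 : ∀ {n} {f : R n} → f ≈ 𝟎 → ∑ f ≡ 0ℚ
∑-≈0 {n} f≈0 = trans (∑-cong f≈0) (∑-zero {n})

infix 9 ⟪_,_⟫

⟪_,_⟫ : ∀ {n} → R n → R n → ℚ
⟪ p , q ⟫ = ∑ λ A → p A * q A

dot-cong : ∀ {n} {p p′ q q′ : R n} → p ≈ p′ → q ≈ q′ → ⟪ p , q ⟫ ≡ ⟪ p′ , q′ ⟫
dot-cong p≈ q≈ = ∑-cong λ A → cong₂ _*_ (p≈ A) (q≈ A)

dot-congʳ : ∀ {n} (p : R n) {q q′ : R n} → q ≈ q′ → ⟪ p , q ⟫ ≡ ⟪ p , q′ ⟫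
dot-congʳ p {q} {q′} = dot-cong {p = p} {p} {q} {q′} (λ _ → refl)

dot-congˡ : ∀ {n} {p p′ : R n} (q : R n) → p ≈ p′ → ⟪ p , q ⟫ ≡ ⟪ p′ , q ⟫
dot-congˡ {p = p} {p′} q p≈ = dot-cong {p = p} {p′} {q} {q} p≈ (λ _ → refl)

dot-comm : ∀ {n} (p q : R n) → ⟪ p , q ⟫ ≡ ⟪ q , p ⟫
dot-comm p q = ∑-cong λ A → ℚ.*-comm (p A) (q A)

dot-⊕ʳ : ∀ {n} (p q s : R n) → ⟪ p , q ⊕ s ⟫ ≡ ⟪ p , q ⟫ + ⟪ p , s ⟫
dot-⊕ʳ p q s = trans (∑-cong λ A → ℚ.*-distribˡ-+ (p A) (q A) (s A))
                     (∑-+ (λ A → p A * q A) (λ A → p A * s A))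

dot-•ʳ : ∀ {n} (p : R n) c (q : R n) → ⟪ p , c • q ⟫ ≡ c * ⟪ p , q ⟫
dot-•ʳ p c q = trans
  (∑-cong λ A → solve 3 (λ x y z → x :* (y :* z) := y :* (x :* z)) refl (p A) c (q A))
  (∑-* c (λ A → p A * q A))

dot-⊕ˡ : ∀ {n} (p q s : R n) → ⟪ p ⊕ q , s ⟫ ≡ ⟪ p , s ⟫ + ⟪ q , s ⟫
dot-⊕ˡ p q s = trans (dot-comm (p ⊕ q) s)
  (trans (dot-⊕ʳ s p q) (cong₂ _+_ (dot-comm s p) (dot-comm s q)))

dot-•ˡ : ∀ {n} c (p q : R n) → ⟪ c • p , q ⟫ ≡ c * ⟪ p , q ⟫
dot-•ˡ c p q = trans (dot-comm (c • p) q)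
  (trans (dot-•ʳ q c p) (cong (c *_) (dot-comm q p)))

dot-zeroʳ : ∀ {n} (p : R n) {q : R n} → q ≈ 𝟎 → ⟪ p , q ⟫ ≡ 0ℚ
dot-zeroʳ p q≈0 = ∑-≈0 λ A → trans (cong (p A *_) (q≈0 A)) (ℚ.*-zeroʳ (p A))

dot-zeroˡ : ∀ {n} {p : R n} (q : R n) → p ≈ 𝟎 → ⟪ p , q ⟫ ≡ 0ℚ
dot-zeroˡ {p = p} q p≈0 = trans (dot-comm p q) (dot-zeroʳ q p≈0)

-- Signs of products of monomials

#below-suc : ∀ {m n} (i : Fin m) (xs : List (Fin n)) →
  length (filter (Fin._<? suc i) (map suc xs)) ≡ length (filter (Fin._<? i) xs)
#below-suc i []       = refl
#below-suc i (x ∷ xs) with does (x Fin.<? i)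
... | true  = cong suc (#below-suc i xs)
... | false = #below-suc i xs

#below-zero : ∀ {n} (A : Subset (suc n)) → #below zero A ≡ 0
#below-zero {n} A = none {n} (elements A)
  where
  none : ∀ {m n} (xs : List (Fin n)) → length (filter (Fin._<? zero {m}) xs) ≡ 0
  none []       = refl
  none {m} (x ∷ xs) = none {m} xs

#below-out : ∀ {n} (i : Fin n) A → #below (suc i) (outside ∷ A) ≡ #below i A
#below-out i A = #below-suc i (elements A)

#below-in : ∀ {n} (i : Fin n) A → #below (suc i) (inside ∷ A) ≡ suc (#below i A)
#below-in i A = cong suc (#below-suc i (elements A))

inversions-out : ∀ {n} (A B : Subset n) → inversions (outside ∷ A) (outside ∷ B) ≡ inversions A B
inversions-out A B = cong ℕ-sum (trans (sym (List.map-∘ {g = λ a → #below a (outside ∷ B)} (elements A)))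
  (List.map-cong {f = λ a → #below (suc a) (outside ∷ B)} {g = λ a → #below a B} (λ a → #below-out a B) (elements A)))

length-elements : ∀ {n} (A : Subset n) → length (elements A) ≡ ∣ A ∣
length-elements []            = refl
length-elements (inside  ∷ A) = cong suc (trans (List.length-map suc (elements A)) (length-elements A))
length-elements (outside ∷ A) = trans (List.length-map suc (elements A)) (length-elements A)

-- The new least index of the right factor lies below each of the `∣ A ∣` indices of the left one.
inversions-out-in : ∀ {n} (A B : Subset n) →
  inversions (outside ∷ A) (inside ∷ B) ≡ ∣ A ∣ ℕ.+ inversions A B
inversions-out-in A B = begin
  ℕ-sum (map (λ a → #below a (inside ∷ B)) (map suc (elements A)))
    ≡⟨ cong ℕ-sum (sym (List.map-∘ (elements A))) ⟩
  ℕ-sum (map (λ a → #below (suc a) (inside ∷ B)) (elements A))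
    ≡⟨ cong ℕ-sum (List.map-cong (λ a → #below-in a B) (elements A)) ⟩
  ℕ-sum (map (λ a → suc (#below a B)) (elements A))
    ≡⟨ sum-suc (λ a → #below a B) (elements A) ⟩
  length (elements A) ℕ.+ inversions A B
    ≡⟨ cong (ℕ._+ inversions A B) (length-elements A) ⟩
  ∣ A ∣ ℕ.+ inversions A B ∎
  where
  sum-suc : ∀ {a} {X : Set a} (f : X → ℕ) xs →
            ℕ-sum (map (suc ∘ f) xs) ≡ length xs ℕ.+ ℕ-sum (map f xs)
  sum-suc f []       = refl
  sum-suc f (x ∷ xs) = cong suc (trans (cong (f x ℕ.+_) (sum-suc f xs))
    (trans (sym (ℕ.+-assoc (f x) (length xs) _))
    (trans (cong (ℕ._+ ℕ-sum (map f xs)) (ℕ.+-comm (f x) (length xs)))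
           (ℕ.+-assoc (length xs) (f x) _))))

inversions-in : ∀ {n} (A B : Subset n) b →
  inversions (inside ∷ A) (b ∷ B) ≡ inversions (outside ∷ A) (b ∷ B)
inversions-in A B b = cong (ℕ._+ inversions (outside ∷ A) (b ∷ B)) (#below-zero (b ∷ B))

-1^-+ : ∀ m n → -1^ (m ℕ.+ n) ≡ (-1^ m) * (-1^ n)
-1^-+ zero    n = sym (ℚ.*-identityˡ (-1^ n))
-1^-+ (suc m) n = trans (cong -_ (-1^-+ m n)) (ℚ.neg-distribˡ-* (-1^ m) (-1^ n))

-1^-square : ∀ m → (-1^ m) * (-1^ m) ≡ 1ℚ
-1^-square zero    = refl
-1^-square (suc m) = trans (solve 1 (λ x → (:- x) :* (:- x) := x :* x) refl (-1^ m)) (-1^-square m)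

nonempty-out : ∀ {n} (A : Subset n) → does (nonempty? (outside ∷ A)) ≡ does (nonempty? A)
nonempty-out A = does-⇔ (mk⇔ (λ { (suc i , there h) → i , h }) (λ (i , h) → suc i , there h))
  (nonempty? (outside ∷ A)) (nonempty? A)

-- The `mp-` lemmas form the multiplication table for the first variable. The case where both sets
-- contain it is missing because there the product vanishes by computation.
mp-oo-o : ∀ {n} (A B C : Subset n) →
  monomialProduct (outside ∷ A) (outside ∷ B) (outside ∷ C) ≡ monomialProduct A B C
mp-oo-o A B C rewrite nonempty-out (A ∩ B) | inversions-out A B with does (nonempty? (A ∩ B))
... | true  = refl
... | false = refl

mp-oo-i : ∀ {n} (A B C : Subset n) →
  monomialProduct (outside ∷ A) (outside ∷ B) (inside ∷ C) ≡ 0ℚ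
mp-oo-i A B C rewrite nonempty-out (A ∩ B) with does (nonempty? (A ∩ B))
... | true  = refl
... | false = ℚ.*-zeroʳ (-1^ inversions (outside ∷ A) (outside ∷ B))

mp-io-o : ∀ {n} (A B C : Subset n) →
  monomialProduct (inside ∷ A) (outside ∷ B) (outside ∷ C) ≡ 0ℚ
mp-io-o A B C rewrite nonempty-out (A ∩ B) with does (nonempty? (A ∩ B))
... | true  = refl
... | false = ℚ.*-zeroʳ (-1^ inversions (inside ∷ A) (outside ∷ B))

mp-io-i : ∀ {n} (A B C : Subset n) →
  monomialProduct (inside ∷ A) (outside ∷ B) (inside ∷ C) ≡ monomialProduct A B C
mp-io-i A B C rewrite nonempty-out (A ∩ B) | inversions-in A B outside | inversions-out A B
  with does (nonempty? (A ∩ B))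
... | true  = refl
... | false = refl

mp-oi-o : ∀ {n} (A B C : Subset n) →
  monomialProduct (outside ∷ A) (inside ∷ B) (outside ∷ C) ≡ 0ℚ
mp-oi-o A B C rewrite nonempty-out (A ∩ B) with does (nonempty? (A ∩ B))
... | true  = refl
... | false = ℚ.*-zeroʳ (-1^ inversions (outside ∷ A) (inside ∷ B))

mp-oi-i : ∀ {n} (A B C : Subset n) →
  monomialProduct (outside ∷ A) (inside ∷ B) (inside ∷ C) ≡ (-1^ ∣ A ∣) * monomialProduct A B C
mp-oi-i A B C rewrite nonempty-out (A ∩ B) | inversions-out-in A B | -1^-+ ∣ A ∣ (inversions A B)
  with does (nonempty? (A ∩ B))
... | true  = sym (ℚ.*-zeroʳ (-1^ ∣ A ∣))
... | false = ℚ.*-assoc (-1^ ∣ A ∣) (-1^ inversions A B) (θ[ A ∪ B ] C)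

-- The parity automorphism: the sign of moving one variable past each monomial.
σ : ∀ {n} → R n → R n
σ p A = (-1^ ∣ A ∣) * p A

⊛-out : ∀ {n} (p q : R (suc n)) → (p ⊛ q) ⁰ ≈ p ⁰ ⊛ q ⁰
⊛-out p q C = trans (cong₂ _+_
  (dot-congʳ (p ⁰) λ A → trans (cong₂ _+_
    (dot-congʳ (q ⁰) λ B → mp-oo-o A B C)
    (dot-zeroʳ (q ¹) λ B → mp-oi-o A B C))
    (ℚ.+-identityʳ ⟪ q ⁰ , (λ B → monomialProduct A B C) ⟫))
  (dot-zeroʳ (p ¹) λ A → cong₂ _+_
    (dot-zeroʳ (q ⁰) λ B → mp-io-o A B C)
    (dot-zeroʳ (q ¹) λ B → refl)))
  (ℚ.+-identityʳ ((p ⁰ ⊛ q ⁰) C))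

-- In the product of `p ⁰` with θ₁ `q ¹`, the variable θ₁ has to be brought to the front past `p ⁰`,
-- whence the `σ`.
⊛-in : ∀ {n} (p q : R (suc n)) → (p ⊛ q) ¹ ≈ p ¹ ⊛ q ⁰ ⊕ σ (p ⁰) ⊛ q ¹
⊛-in p q C = trans (cong₂ _+_
  (trans (dot-congʳ (p ⁰) λ A → trans (cong₂ _+_
      (dot-zeroʳ (q ⁰) λ B → mp-oo-i A B C)
      (dot-congʳ (q ¹) λ B → mp-oi-i A B C))
      (trans (ℚ.+-identityˡ ⟪ q ¹ , (λ B → (-1^ ∣ A ∣) * monomialProduct A B C) ⟫)
             (dot-•ʳ (q ¹) (-1^ ∣ A ∣) (λ B → monomialProduct A B C))))
    (∑-cong λ A → solve 3 (λ x y z → x :* (y :* z) := (y :* x) :* z) refl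
      ((p ⁰) A) (-1^ ∣ A ∣) ⟪ q ¹ , (λ B → monomialProduct A B C) ⟫))
  (dot-congʳ (p ¹) λ A → trans (cong₂ _+_
    (dot-congʳ (q ⁰) λ B → mp-io-i A B C)
    (dot-zeroʳ (q ¹) λ B → refl))
    (ℚ.+-identityʳ ⟪ q ⁰ , (λ B → monomialProduct A B C) ⟫)))
  (ℚ.+-comm ((σ (p ⁰) ⊛ q ¹) C) ((p ¹ ⊛ q ⁰) C))

-- Algebra laws of the product.

≈-refl : ∀ {n} {p : R n} → p ≈ p
≈-refl A = refl

≈-sym : ∀ {n} {p q : R n} → p ≈ q → q ≈ p
≈-sym p≈q A = sym (p≈q A)

≈-trans : ∀ {n} {p q s : R n} → p ≈ q → q ≈ s → p ≈ s
≈-trans p≈q q≈s A = trans (p≈q A) (q≈s A)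

⊕-cong : ∀ {n} {p p′ q q′ : R n} → p ≈ p′ → q ≈ q′ → p ⊕ q ≈ p′ ⊕ q′
⊕-cong p≈ q≈ A = cong₂ _+_ (p≈ A) (q≈ A)

⊛-cong : ∀ {n} {p p′ q q′ : R n} → p ≈ p′ → q ≈ q′ → p ⊛ q ≈ p′ ⊛ q′
⊛-cong {q = q} {q′} p≈ q≈ C = dot-cong p≈ λ A → dot-cong {p = q} {q′} q≈ λ B → refl

⊛-congˡ : ∀ {n} {p p′ : R n} (q : R n) → p ≈ p′ → p ⊛ q ≈ p′ ⊛ q
⊛-congˡ q p≈ = ⊛-cong {q = q} {q} p≈ (≈-refl {p = q})

⊛-congʳ : ∀ {n} (p : R n) {q q′ : R n} → q ≈ q′ → p ⊛ q ≈ p ⊛ q′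
⊛-congʳ p q≈ = ⊛-cong {p = p} {p} (≈-refl {p = p}) q≈

module _ {n : ℕ} where
  private
    mp∙ : R n → Subset n → R n
    mp∙ q C A = ⟪ q , (λ B → monomialProduct A B C) ⟫

  ⊛-⊕ˡ : (p q s : R n) → (p ⊕ q) ⊛ s ≈ p ⊛ s ⊕ q ⊛ s
  ⊛-⊕ˡ p q s C = dot-⊕ˡ p q (mp∙ s C)

  ⊛-•ˡ : ∀ c (p q : R n) → (c • p) ⊛ q ≈ c • (p ⊛ q)
  ⊛-•ˡ c p q C = dot-•ˡ c p (mp∙ q C)

  ⊛-⊕ʳ : (p q s : R n) → p ⊛ (q ⊕ s) ≈ p ⊛ q ⊕ p ⊛ s
  ⊛-⊕ʳ p q s C = trans
    (dot-congʳ p λ A → dot-⊕ˡ q s (λ B → monomialProduct A B C))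
    (dot-⊕ʳ p (mp∙ q C) (mp∙ s C))

  ⊛-•ʳ : (p : R n) → ∀ c (q : R n) → p ⊛ (c • q) ≈ c • (p ⊛ q)
  ⊛-•ʳ p c q C = trans
    (dot-congʳ p λ A → dot-•ˡ c q (λ B → monomialProduct A B C))
    (dot-•ʳ p c (mp∙ q C))

  ⊛-zeroˡ : {p : R n} (q : R n) → p ≈ 𝟎 → p ⊛ q ≈ 𝟎
  ⊛-zeroˡ q p≈0 C = dot-zeroˡ (mp∙ q C) p≈0

  ⊛-zeroʳ : (p : R n) {q : R n} → q ≈ 𝟎 → p ⊛ q ≈ 𝟎
  ⊛-zeroʳ p q≈0 C = dot-zeroʳ p λ A → dot-zeroˡ (λ B → monomialProduct A B C) q≈0

⊛-[] : (p q : R 0) → (p ⊛ q) [] ≡ p [] * q []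
⊛-[] p q = cong (p [] *_) (ℚ.*-identityʳ (q []))

σ-cong : ∀ {n} {p q : R n} → p ≈ q → σ p ≈ σ q
σ-cong p≈q A = cong ((-1^ ∣ A ∣) *_) (p≈q A)

σ-𝟏 : ∀ {n} → σ {n} 𝟏 ≈ 𝟏
σ-𝟏 []            = refl
σ-𝟏 (outside ∷ A) = σ-𝟏 A
σ-𝟏 (inside  ∷ A) = ℚ.*-zeroʳ (-1^ suc ∣ A ∣)

⊛-identityˡ : ∀ {n} (q : R n) → 𝟏 ⊛ q ≈ q
⊛-identityˡ q [] = trans (⊛-[] 𝟏 q) (ℚ.*-identityˡ (q []))
⊛-identityˡ q (outside ∷ A) = trans (⊛-out 𝟏 q A) (⊛-identityˡ (q ⁰) A)
⊛-identityˡ q (inside  ∷ A) = begin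
  (𝟏 ⊛ q) (inside ∷ A)              ≡⟨ ⊛-in 𝟏 q A ⟩
  (𝟎 ⊛ q ⁰) A + (σ 𝟏 ⊛ q ¹) A       ≡⟨ cong₂ _+_ (⊛-zeroˡ (q ⁰) ≈-refl A) (⊛-congˡ (q ¹) σ-𝟏 A) ⟩
  0ℚ + (𝟏 ⊛ q ¹) A                  ≡⟨ ℚ.+-identityˡ ((𝟏 ⊛ q ¹) A) ⟩
  (𝟏 ⊛ q ¹) A                       ≡⟨ ⊛-identityˡ (q ¹) A ⟩
  q (inside ∷ A)                    ∎

⊛-identityʳ : ∀ {n} (p : R n) → p ⊛ 𝟏 ≈ p
⊛-identityʳ p [] = trans (⊛-[] p 𝟏) (ℚ.*-identityʳ (p []))
⊛-identityʳ p (outside ∷ A) = trans (⊛-out p 𝟏 A) (⊛-identityʳ (p ⁰) A)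
⊛-identityʳ p (inside  ∷ A) = trans (⊛-in p 𝟏 A)
  (trans (cong₂ _+_ (⊛-identityʳ (p ¹) A) (⊛-zeroʳ (σ (p ⁰)) ≈-refl A))
         (ℚ.+-identityʳ (p (inside ∷ A))))

σ-⊛ : ∀ {n} (p q : R n) → σ (p ⊛ q) ≈ σ p ⊛ σ q
σ-⊛ p q [] = begin
  1ℚ * (p ⊛ q) []             ≡⟨ cong (1ℚ *_) (⊛-[] p q) ⟩
  1ℚ * (p [] * q [])
    ≡⟨ solve 2 (λ x y → con 1ℚ :* (x :* y) := (con 1ℚ :* x) :* (con 1ℚ :* y)) refl (p []) (q []) ⟩
  (1ℚ * p []) * (1ℚ * q [])   ≡⟨ ⊛-[] (σ p) (σ q) ⟨
  (σ p ⊛ σ q) []              ∎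
σ-⊛ p q (outside ∷ A) = begin
  s * (p ⊛ q) (outside ∷ A)  ≡⟨ cong (s *_) (⊛-out p q A) ⟩
  σ (p ⁰ ⊛ q ⁰) A            ≡⟨ σ-⊛ (p ⁰) (q ⁰) A ⟩
  (σ (p ⁰) ⊛ σ (q ⁰)) A      ≡⟨ ⊛-out (σ p) (σ q) A ⟨
  (σ p ⊛ σ q) (outside ∷ A)  ∎
  where
  s = -1^ ∣ A ∣
σ-⊛ p q (inside ∷ A) = begin
  - s * (p ⊛ q) (inside ∷ A)                          ≡⟨ cong (- s *_) (⊛-in p q A) ⟩
  - s * ((p ¹ ⊛ q ⁰) A + (σ (p ⁰) ⊛ q ¹) A)
    ≡⟨ solve 3 (λ s x y → :- s :* (x :+ y) := con (- 1ℚ) :* (s :* x) :+ con (- 1ℚ) :* (s :* y)) refl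
         s ((p ¹ ⊛ q ⁰) A) ((σ (p ⁰) ⊛ q ¹) A) ⟩
  - 1ℚ * σ (p ¹ ⊛ q ⁰) A + - 1ℚ * σ (σ (p ⁰) ⊛ q ¹) A
    ≡⟨ cong₂ (λ x y → - 1ℚ * x + - 1ℚ * y) (σ-⊛ (p ¹) (q ⁰) A) (σ-⊛ (σ (p ⁰)) (q ¹) A) ⟩
  - 1ℚ * (σ (p ¹) ⊛ σ (q ⁰)) A + - 1ℚ * (σ (σ (p ⁰)) ⊛ σ (q ¹)) A
    ≡⟨ cong₂ _+_ (⊛-•ˡ (- 1ℚ) (σ (p ¹)) (σ (q ⁰)) A) (⊛-•ʳ (σ (σ (p ⁰))) (- 1ℚ) (σ (q ¹)) A) ⟨
  ((- 1ℚ • σ (p ¹)) ⊛ σ (q ⁰)) A + (σ (σ (p ⁰)) ⊛ (- 1ℚ • σ (q ¹))) A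
    ≡⟨ cong₂ _+_ (⊛-congˡ (σ (q ⁰)) (σ-in p) A) (⊛-congʳ (σ (σ (p ⁰))) (σ-in q) A) ⟨
  (σ p ¹ ⊛ σ (q ⁰)) A + (σ (σ (p ⁰)) ⊛ σ q ¹) A       ≡⟨ ⊛-in (σ p) (σ q) A ⟨
  (σ p ⊛ σ q) (inside ∷ A)  ∎
  where
  s = -1^ ∣ A ∣
  σ-in : ∀ {n} (p : R (suc n)) → σ p ¹ ≈ - 1ℚ • σ (p ¹)
  σ-in p A = solve 2 (λ s x → :- s :* x := con (- 1ℚ) :* (s :* x)) refl (-1^ ∣ A ∣) ((p ¹) A)

-- The `inside` half rests on `σ-⊛`: θ₁ from the third factor passes `p ⁰ ⊛ q ⁰` at once on one
-- side, and `q ⁰`, then `p ⁰` on the other.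
⊛-assoc : ∀ {n} (p q s : R n) → (p ⊛ q) ⊛ s ≈ p ⊛ (q ⊛ s)
⊛-assoc p q s [] = begin
  ((p ⊛ q) ⊛ s) []       ≡⟨ ⊛-[] (p ⊛ q) s ⟩
  (p ⊛ q) [] * s []      ≡⟨ cong (_* s []) (⊛-[] p q) ⟩
  (p [] * q []) * s []   ≡⟨ ℚ.*-assoc (p []) (q []) (s []) ⟩
  p [] * (q [] * s [])   ≡⟨ cong (p [] *_) (⊛-[] q s) ⟨
  p [] * (q ⊛ s) []      ≡⟨ ⊛-[] p (q ⊛ s) ⟨
  (p ⊛ (q ⊛ s)) []       ∎
⊛-assoc p q s (outside ∷ A) = begin
  ((p ⊛ q) ⊛ s) (outside ∷ A)  ≡⟨ ⊛-out (p ⊛ q) s A ⟩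
  ((p ⊛ q) ⁰ ⊛ s ⁰) A          ≡⟨ ⊛-congˡ (s ⁰) (⊛-out p q) A ⟩
  ((p ⁰ ⊛ q ⁰) ⊛ s ⁰) A        ≡⟨ ⊛-assoc (p ⁰) (q ⁰) (s ⁰) A ⟩
  (p ⁰ ⊛ (q ⁰ ⊛ s ⁰)) A        ≡⟨ ⊛-congʳ (p ⁰) (⊛-out q s) A ⟨
  (p ⁰ ⊛ (q ⊛ s) ⁰) A          ≡⟨ ⊛-out p (q ⊛ s) A ⟨
  (p ⊛ (q ⊛ s)) (outside ∷ A)  ∎
⊛-assoc p q s (inside ∷ A) = begin
  ((p ⊛ q) ⊛ s) (inside ∷ A)
    ≡⟨ ⊛-in (p ⊛ q) s A ⟩
  ((p ⊛ q) ¹ ⊛ s ⁰) A + (σ ((p ⊛ q) ⁰) ⊛ s ¹) A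
    ≡⟨ cong₂ _+_ (⊛-congˡ (s ⁰) (⊛-in p q) A)
                 (⊛-congˡ (s ¹) (≈-trans (σ-cong (⊛-out p q)) (σ-⊛ (p ⁰) (q ⁰))) A) ⟩
  ((p ¹ ⊛ q ⁰ ⊕ σ (p ⁰) ⊛ q ¹) ⊛ s ⁰) A + ((σ (p ⁰) ⊛ σ (q ⁰)) ⊛ s ¹) A
    ≡⟨ cong₂ _+_ (⊛-⊕ˡ (p ¹ ⊛ q ⁰) (σ (p ⁰) ⊛ q ¹) (s ⁰) A) (⊛-assoc (σ (p ⁰)) (σ (q ⁰)) (s ¹) A) ⟩
  (((p ¹ ⊛ q ⁰) ⊛ s ⁰) A + ((σ (p ⁰) ⊛ q ¹) ⊛ s ⁰) A) + (σ (p ⁰) ⊛ (σ (q ⁰) ⊛ s ¹)) A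
    ≡⟨ cong₂ (λ x y → (x + y) + (σ (p ⁰) ⊛ (σ (q ⁰) ⊛ s ¹)) A)
         (⊛-assoc (p ¹) (q ⁰) (s ⁰) A) (⊛-assoc (σ (p ⁰)) (q ¹) (s ⁰) A) ⟩
  ((p ¹ ⊛ (q ⁰ ⊛ s ⁰)) A + (σ (p ⁰) ⊛ (q ¹ ⊛ s ⁰)) A) + (σ (p ⁰) ⊛ (σ (q ⁰) ⊛ s ¹)) A
    ≡⟨ ℚ.+-assoc ((p ¹ ⊛ (q ⁰ ⊛ s ⁰)) A) ((σ (p ⁰) ⊛ (q ¹ ⊛ s ⁰)) A) ((σ (p ⁰) ⊛ (σ (q ⁰) ⊛ s ¹)) A) ⟩
  (p ¹ ⊛ (q ⁰ ⊛ s ⁰)) A + ((σ (p ⁰) ⊛ (q ¹ ⊛ s ⁰)) A + (σ (p ⁰) ⊛ (σ (q ⁰) ⊛ s ¹)) A)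
    ≡⟨ cong ((p ¹ ⊛ (q ⁰ ⊛ s ⁰)) A +_) (⊛-⊕ʳ (σ (p ⁰)) (q ¹ ⊛ s ⁰) (σ (q ⁰) ⊛ s ¹) A) ⟨
  (p ¹ ⊛ (q ⁰ ⊛ s ⁰)) A + (σ (p ⁰) ⊛ (q ¹ ⊛ s ⁰ ⊕ σ (q ⁰) ⊛ s ¹)) A
    ≡⟨ cong₂ _+_ (⊛-congʳ (p ¹) (⊛-out q s) A) (⊛-congʳ (σ (p ⁰)) (⊛-in q s) A) ⟨
  (p ¹ ⊛ (q ⊛ s) ⁰) A + (σ (p ⁰) ⊛ (q ⊛ s) ¹) A
    ≡⟨ ⊛-in p (q ⊛ s) A ⟨
  (p ⊛ (q ⊛ s)) (inside ∷ A) ∎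

-- The generators, their commutation signs and their adjoints.

F-zero : ∀ {n} → F {n} 0 ≈ 𝟏
F-zero []            = refl
F-zero (outside ∷ A) = F-zero A
F-zero (inside  ∷ A) = refl

σ-F : ∀ {n} r → σ (F {n} r) ≈ (-1^ r) • F r
σ-F zero    []            = refl
σ-F (suc r) []            = sym (ℚ.*-zeroʳ (-1^ suc r))
σ-F r       (outside ∷ A) = σ-F r A
σ-F zero    (inside  ∷ A) = ℚ.*-zeroʳ (-1^ suc ∣ A ∣)
σ-F (suc r) (inside  ∷ A) = begin
  - s * F r A            ≡⟨ solve 2 (λ s x → :- s :* x := :- (s :* x)) refl s (F r A) ⟩
  - (s * F r A)          ≡⟨ cong -_ (σ-F r A) ⟩
  - ((-1^ r) * F r A)    ≡⟨ solve 2 (λ s x → :- (s :* x) := :- s :* x) refl (-1^ r) (F r A) ⟩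
  (- (-1^ r)) * F r A ∎
  where
  s = -1^ ∣ A ∣

-- The `r`-fold iterate of `σ`, kept as one sign: that of moving `r` variables past a monomial.
σ^ : ∀ {n} → ℕ → R n → R n
σ^ r p A = (-1^ (r ℕ.* ∣ A ∣)) * p A

σ^-in : ∀ {n} r (p : R (suc n)) → σ^ r p ¹ ≈ (-1^ r) • σ^ r (p ¹)
σ^-in r p A = begin
  (-1^ (r ℕ.* suc ∣ A ∣)) * (p ¹) A
    ≡⟨ cong (λ k → (-1^ k) * (p ¹) A) (ℕ.*-suc r ∣ A ∣) ⟩
  (-1^ (r ℕ.+ r ℕ.* ∣ A ∣)) * (p ¹) A
    ≡⟨ cong (_* (p ¹) A) (-1^-+ r (r ℕ.* ∣ A ∣)) ⟩
  ((-1^ r) * (-1^ (r ℕ.* ∣ A ∣))) * (p ¹) A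
    ≡⟨ ℚ.*-assoc (-1^ r) (-1^ (r ℕ.* ∣ A ∣)) ((p ¹) A) ⟩
  (-1^ r) * σ^ r (p ¹) A ∎

σ^-σ : ∀ {n} r (p : R n) → σ^ r (σ p) ≈ σ^ (suc r) p
σ^-σ r p A = begin
  t * (s * p A)   ≡⟨ solve 3 (λ t s x → t :* (s :* x) := (s :* t) :* x) refl t s (p A) ⟩
  (s * t) * p A   ≡⟨ cong (_* p A) (-1^-+ ∣ A ∣ (r ℕ.* ∣ A ∣)) ⟨
  σ^ (suc r) p A  ∎
  where
  s = -1^ ∣ A ∣
  t = -1^ (r ℕ.* ∣ A ∣)

-- Monomials of degrees k and r commute up to (-1)^(kr). As `F r` is homogeneous, this sign depends
-- only on the monomial of `p`.
⊛-F : ∀ {n} (p : R n) r → p ⊛ F r ≈ F r ⊛ σ^ r p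
⊛-F p zero A = begin
  (p ⊛ F 0) A         ≡⟨ ⊛-congʳ p F-zero A ⟩
  (p ⊛ 𝟏) A           ≡⟨ ⊛-identityʳ p A ⟩
  p A                 ≡⟨ ℚ.*-identityˡ (p A) ⟨
  σ^ 0 p A            ≡⟨ ⊛-identityˡ (σ^ 0 p) A ⟨
  (𝟏 ⊛ σ^ 0 p) A      ≡⟨ ⊛-congˡ (σ^ 0 p) F-zero A ⟨
  (F 0 ⊛ σ^ 0 p) A    ∎
⊛-F p (suc r) [] = begin
  (p ⊛ F (suc r)) []                 ≡⟨ ⊛-[] p (F (suc r)) ⟩
  p [] * 0ℚ                          ≡⟨ ℚ.*-zeroʳ (p []) ⟩
  0ℚ                                 ≡⟨ ℚ.*-zeroˡ (σ^ (suc r) p []) ⟨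
  0ℚ * σ^ (suc r) p []               ≡⟨ ⊛-[] (F (suc r)) (σ^ (suc r) p) ⟨
  (F (suc r) ⊛ σ^ (suc r) p) []      ∎
⊛-F p (suc r) (outside ∷ A) = begin
  (p ⊛ F (suc r)) (outside ∷ A)      ≡⟨ ⊛-out p (F (suc r)) A ⟩
  (p ⁰ ⊛ F (suc r)) A                ≡⟨ ⊛-F (p ⁰) (suc r) A ⟩
  (F (suc r) ⊛ σ^ (suc r) (p ⁰)) A   ≡⟨ ⊛-out (F (suc r)) (σ^ (suc r) p) A ⟨
  (F (suc r) ⊛ σ^ (suc r) p) (outside ∷ A) ∎
⊛-F p (suc r) (inside ∷ A) = begin
  (p ⊛ F (suc r)) (inside ∷ A)
    ≡⟨ ⊛-in p (F (suc r)) A ⟩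
  (p ¹ ⊛ F (suc r)) A + (σ (p ⁰) ⊛ F r) A
    ≡⟨ cong₂ _+_ (⊛-F (p ¹) (suc r) A) (⊛-F (σ (p ⁰)) r A) ⟩
  (F (suc r) ⊛ x) A + (F r ⊛ σ^ r (σ (p ⁰))) A
    ≡⟨ cong₂ _+_ (sym (ℚ.*-identityˡ ((F (suc r) ⊛ x) A))) (⊛-congʳ (F r) (σ^-σ r (p ⁰)) A) ⟩
  1ℚ * (F (suc r) ⊛ x) A + (F r ⊛ σ^ (suc r) (p ⁰)) A
    -- The factor 1 becomes `s * s`: one sign is needed to form `σ (F (suc r))`, the other for
    -- `σ^-in`.
    ≡⟨ cong (λ z → z * (F (suc r) ⊛ x) A + (F r ⊛ σ^ (suc r) (p ⁰)) A) (-1^-square (suc r)) ⟨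
  s * s * (F (suc r) ⊛ x) A + (F r ⊛ σ^ (suc r) (p ⁰)) A
    ≡⟨ solve 3 (λ s x y → s :* s :* x :+ y := y :+ s :* (s :* x)) refl
         s ((F (suc r) ⊛ x) A) ((F r ⊛ σ^ (suc r) (p ⁰)) A) ⟩
  (F r ⊛ σ^ (suc r) (p ⁰)) A + s * (s * (F (suc r) ⊛ x) A)
    ≡⟨ cong ((F r ⊛ σ^ (suc r) (p ⁰)) A +_) (cong (s *_) (⊛-•ʳ (F (suc r)) s x A)) ⟨
  (F r ⊛ σ^ (suc r) (p ⁰)) A + s * (F (suc r) ⊛ (s • x)) A
    ≡⟨ cong ((F r ⊛ σ^ (suc r) (p ⁰)) A +_) (⊛-•ˡ s (F (suc r)) (s • x) A) ⟨
  (F r ⊛ σ^ (suc r) (p ⁰)) A + ((s • F (suc r)) ⊛ (s • x)) A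
    ≡⟨ cong ((F r ⊛ σ^ (suc r) (p ⁰)) A +_) (⊛-cong (σ-F (suc r)) (σ^-in (suc r) p) A) ⟨
  (F r ⊛ σ^ (suc r) (p ⁰)) A + (σ (F (suc r)) ⊛ σ^ (suc r) p ¹) A
    ≡⟨ ⊛-in (F (suc r)) (σ^ (suc r) p) A ⟨
  (F (suc r) ⊛ σ^ (suc r) p) (inside ∷ A) ∎
  where
  s = -1^ (suc r)
  x = σ^ (suc r) (p ¹)

-- The recursion is the transpose of `⊛-out` and `⊛-in` for the left factor `F (suc r)`. Its half
-- with θ₁ is `F r`, which gives the term `E r (q ¹)`; the sign in the last clause comes from `σ-F`.
E : ∀ {n} → ℕ → R n → R n
E         zero    q A             = q A
E {zero}  (suc r) q A             = 0ℚ
E {suc n} (suc r) q (outside ∷ A) = E (suc r) (q ⁰) A + E r (q ¹) A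
E {suc n} (suc r) q (inside  ∷ A) = (-1^ suc r) * E (suc r) (q ¹) A

dot-F : ∀ {n} r (p q : R n) → ⟪ F r ⊛ p , q ⟫ ≡ ⟪ p , E r q ⟫
dot-F zero p q = dot-congˡ q (≈-trans (⊛-congˡ p F-zero) (⊛-identityˡ p))
dot-F {zero} (suc r) p q = begin
  (F (suc r) ⊛ p) [] * q []   ≡⟨ cong (_* q []) (⊛-[] (F (suc r)) p) ⟩
  0ℚ * p [] * q []            ≡⟨ solve 2 (λ x y → con 0ℚ :* x :* y := x :* con 0ℚ) refl (p []) (q []) ⟩
  p [] * 0ℚ                   ∎
dot-F {suc n} (suc r) p q = begin
  ⟪ (F (suc r) ⊛ p) ⁰ , q ⁰ ⟫ + ⟪ (F (suc r) ⊛ p) ¹ , q ¹ ⟫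
    ≡⟨ cong₂ _+_ (dot-congˡ (q ⁰) (⊛-out (F (suc r)) p))
         (dot-congˡ (q ¹) (≈-trans (⊛-in (F (suc r)) p)
           (⊕-cong {p = F r ⊛ p ⁰} ≈-refl (≈-trans (⊛-congˡ (p ¹) (σ-F (suc r))) (⊛-•ˡ s (F (suc r)) (p ¹)))))) ⟩
  ⟪ F (suc r) ⊛ p ⁰ , q ⁰ ⟫ + ⟪ F r ⊛ p ⁰ ⊕ s • (F (suc r) ⊛ p ¹) , q ¹ ⟫
    ≡⟨ cong (⟪ F (suc r) ⊛ p ⁰ , q ⁰ ⟫ +_) (trans (dot-⊕ˡ (F r ⊛ p ⁰) (s • (F (suc r) ⊛ p ¹)) (q ¹))
         (cong (⟪ F r ⊛ p ⁰ , q ¹ ⟫ +_) (dot-•ˡ s (F (suc r) ⊛ p ¹) (q ¹)))) ⟩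
  ⟪ F (suc r) ⊛ p ⁰ , q ⁰ ⟫ + (⟪ F r ⊛ p ⁰ , q ¹ ⟫ + s * ⟪ F (suc r) ⊛ p ¹ , q ¹ ⟫)
    ≡⟨ cong₂ _+_ (dot-F (suc r) (p ⁰) (q ⁰))
         (cong₂ (λ x y → x + s * y) (dot-F r (p ⁰) (q ¹)) (dot-F (suc r) (p ¹) (q ¹))) ⟩
  ⟪ p ⁰ , E (suc r) (q ⁰) ⟫ + (⟪ p ⁰ , E r (q ¹) ⟫ + s * ⟪ p ¹ , E (suc r) (q ¹) ⟫)
    ≡⟨ ℚ.+-assoc ⟪ p ⁰ , E (suc r) (q ⁰) ⟫ ⟪ p ⁰ , E r (q ¹) ⟫ (s * ⟪ p ¹ , E (suc r) (q ¹) ⟫) ⟨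
  (⟪ p ⁰ , E (suc r) (q ⁰) ⟫ + ⟪ p ⁰ , E r (q ¹) ⟫) + s * ⟪ p ¹ , E (suc r) (q ¹) ⟫
    ≡⟨ cong₂ _+_ (dot-⊕ʳ (p ⁰) (E (suc r) (q ⁰)) (E r (q ¹))) (dot-•ʳ (p ¹) s (E (suc r) (q ¹))) ⟨
  ⟪ p , E (suc r) q ⟫ ∎
  where
  s = -1^ suc r

Harmonic : ∀ {n} → R n → Set
Harmonic q = ∀ r → E (suc r) q ≈ 𝟎

-- Multiplying by F r on either side gives the same left multiples up to signs, so that
-- the two-sided ideal pairs trivially with whatever the left multiples of the F r do.
I⊥Harmonic : ∀ {n} {p q : R n} → p ∈ I n → Harmonic q → ⟪ p , q ⟫ ≡ 0ℚ
I⊥Harmonic {n} {p} {q} p∈I q-harmonic = begin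
  ⟪ p , q ⟫           ≡⟨ dot-congˡ q (≈-trans (⊛-identityʳ (𝟏 ⊛ p)) (⊛-identityˡ p)) ⟨
  ⟪ (𝟏 ⊛ p) ⊛ 𝟏 , q ⟫ ≡⟨ two-sided p∈I 𝟏 𝟏 ⟩
  0ℚ                  ∎
  where
  -- With cofactors on both sides in the induction hypothesis, `mulˡ` and `mulʳ` are absorbed by
  -- associativity, and the sides have to be exchanged only at the generators.
  two-sided : ∀ {p} → p ∈ I n → ∀ f g → ⟪ (f ⊛ p) ⊛ g , q ⟫ ≡ 0ℚ
  two-sided (generator {suc r} 1≤r r≤n) f g = begin
    ⟪ (f ⊛ F (suc r)) ⊛ g , q ⟫             ≡⟨ dot-congˡ q (⊛-congˡ g (⊛-F f (suc r))) ⟩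
    ⟪ (F (suc r) ⊛ σ^ (suc r) f) ⊛ g , q ⟫  ≡⟨ dot-congˡ q (⊛-assoc (F (suc r)) (σ^ (suc r) f) g) ⟩
    ⟪ F (suc r) ⊛ (σ^ (suc r) f ⊛ g) , q ⟫  ≡⟨ dot-F (suc r) (σ^ (suc r) f ⊛ g) q ⟩
    ⟪ σ^ (suc r) f ⊛ g , E (suc r) q ⟫      ≡⟨ dot-zeroʳ (σ^ (suc r) f ⊛ g) (q-harmonic r) ⟩
    0ℚ                                      ∎
  two-sided (resp p≈p′ h) f g =
    trans (dot-congˡ q (⊛-congˡ g (⊛-congʳ f (≈-sym p≈p′)))) (two-sided h f g)
  two-sided zero f g = dot-zeroˡ q (⊛-zeroˡ g (⊛-zeroʳ f ≈-refl))
  two-sided (add {p} {s} h k) f g = begin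
    ⟪ (f ⊛ (p ⊕ s)) ⊛ g , q ⟫
      ≡⟨ dot-congˡ q (≈-trans (⊛-congˡ g (⊛-⊕ʳ f p s)) (⊛-⊕ˡ (f ⊛ p) (f ⊛ s) g)) ⟩
    ⟪ (f ⊛ p) ⊛ g ⊕ (f ⊛ s) ⊛ g , q ⟫
      ≡⟨ dot-⊕ˡ ((f ⊛ p) ⊛ g) ((f ⊛ s) ⊛ g) q ⟩
    ⟪ (f ⊛ p) ⊛ g , q ⟫ + ⟪ (f ⊛ s) ⊛ g , q ⟫
      ≡⟨ cong₂ _+_ (two-sided h f g) (two-sided k f g) ⟩
    0ℚ ∎
  two-sided (scale c {p} h) f g = begin
    ⟪ (f ⊛ (c • p)) ⊛ g , q ⟫
      ≡⟨ dot-congˡ q (≈-trans (⊛-congˡ g (⊛-•ʳ f c p)) (⊛-•ˡ c (f ⊛ p) g)) ⟩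
    ⟪ c • ((f ⊛ p) ⊛ g) , q ⟫  ≡⟨ dot-•ˡ c ((f ⊛ p) ⊛ g) q ⟩
    c * ⟪ (f ⊛ p) ⊛ g , q ⟫    ≡⟨ cong (c *_) (two-sided h f g) ⟩
    c * 0ℚ                     ≡⟨ ℚ.*-zeroʳ c ⟩
    0ℚ                         ∎
  two-sided (mulˡ e {p} h) f g =
    trans (dot-congˡ q (⊛-congˡ g (≈-sym (⊛-assoc f e p)))) (two-sided h (f ⊛ e) g)
  two-sided (mulʳ e {p} h) f g = trans
    (dot-congˡ q (≈-trans (⊛-congˡ g (≈-sym (⊛-assoc f p e))) (⊛-assoc (f ⊛ p) e g)))
    (two-sided h f (e ⊛ g))

E-cong : ∀ {n} r {p q : R n} → p ≈ q → E r p ≈ E r q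
E-cong         zero    p≈q A             = p≈q A
E-cong {zero}  (suc r) p≈q A             = refl
E-cong {suc n} (suc r) p≈q (outside ∷ A) =
  cong₂ _+_ (E-cong (suc r) (p≈q ∘ (outside ∷_)) A) (E-cong r (p≈q ∘ (inside ∷_)) A)
E-cong {suc n} (suc r) p≈q (inside ∷ A)  =
  cong ((-1^ suc r) *_) (E-cong (suc r) (p≈q ∘ (inside ∷_)) A)

E-⊕ : ∀ {n} r (p q : R n) → E r (p ⊕ q) ≈ E r p ⊕ E r q
E-⊕         zero    p q A             = refl
E-⊕ {zero}  (suc r) p q A             = refl
E-⊕ {suc n} (suc r) p q (outside ∷ A) = trans
  (cong₂ _+_ (E-⊕ (suc r) (p ⁰) (q ⁰) A) (E-⊕ r (p ¹) (q ¹) A))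
  (solve 4 (λ a b c d → (a :+ b) :+ (c :+ d) := (a :+ c) :+ (b :+ d)) refl
    (E (suc r) (p ⁰) A) (E (suc r) (q ⁰) A) (E r (p ¹) A) (E r (q ¹) A))
E-⊕ {suc n} (suc r) p q (inside ∷ A)  = trans
  (cong ((-1^ suc r) *_) (E-⊕ (suc r) (p ¹) (q ¹) A))
  (ℚ.*-distribˡ-+ (-1^ suc r) (E (suc r) (p ¹) A) (E (suc r) (q ¹) A))

E-• : ∀ {n} r c (p : R n) → E r (c • p) ≈ c • E r p
E-•         zero    c p A             = refl
E-• {zero}  (suc r) c p A             = sym (ℚ.*-zeroʳ c)
E-• {suc n} (suc r) c p (outside ∷ A) = trans
  (cong₂ _+_ (E-• (suc r) c (p ⁰) A) (E-• r c (p ¹) A))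
  (sym (ℚ.*-distribˡ-+ c (E (suc r) (p ⁰) A) (E r (p ¹) A)))
E-• {suc n} (suc r) c p (inside ∷ A)  = trans
  (cong ((-1^ suc r) *_) (E-• (suc r) c (p ¹) A))
  (solve 3 (λ s c x → s :* (c :* x) := c :* (s :* x)) refl (-1^ suc r) c (E (suc r) (p ¹) A))

E-𝟎 : ∀ {n} r {p : R n} → p ≈ 𝟎 → E r p ≈ 𝟎
E-𝟎 {n} r {p} p≈0 A = begin
  E r p A          ≡⟨ E-cong r (λ A → trans (p≈0 A) (sym (ℚ.*-zeroˡ (p A)))) A ⟩
  E r (0ℚ • p) A   ≡⟨ E-• r 0ℚ p A ⟩
  0ℚ * E r p A     ≡⟨ ℚ.*-zeroˡ (E r p A) ⟩
  0ℚ               ∎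

-- The operators E r are polynomials in E 1 and E 2: dually to F₁ F₂ₖ = F₂ₖ₊₁, F₁ F₂ₖ₊₁ = 0 and
-- F₂ Fₖ = (⌊k/2⌋ + 1) Fₖ₊₂.

double : ℕ → ℕ
double zero    = zero
double (suc k) = suc (suc (double k))

-1^-double : ∀ k → -1^ double k ≡ 1ℚ
-1^-double zero    = refl
-1^-double (suc k) = trans (solve 1 (λ x → :- (:- x) := x) refl (-1^ double k)) (-1^-double k)

E-odd : ∀ {n} k (q : R (suc n)) → E (suc (double k)) q ¹ ≈ - 1ℚ • E (suc (double k)) (q ¹)
E-odd k q A = cong (λ s → - s * E (suc (double k)) (q ¹) A) (-1^-double k)

E-even : ∀ {n} k (q : R (suc n)) → E (double k) q ¹ ≈ E (double k) (q ¹)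
E-even zero    q A = refl
E-even (suc k) q A = trans
  (cong (_* E (double (suc k)) (q ¹) A) (-1^-double (suc k)))
  (ℚ.*-identityˡ (E (double (suc k)) (q ¹) A))

-- Taking one element out of a set gives alternating signs, which cancel for a set of even size and
-- leave 1 for one of odd size. The two parities are proved together because splitting off θ₁ lowers
-- the degree by one.
E-odd-E₁ : ∀ {n} k (q : R n) → E (suc (double k)) (E 1 q) ≈ 𝟎
E-even-E₁ : ∀ {n} k (q : R n) → E (double k) (E 1 q) ≈ E (suc (double k)) q

E-odd-E₁ {zero}  k q A = refl
E-odd-E₁ {suc n} k q (outside ∷ A) = begin
  E (suc (double k)) (E 1 (q ⁰) ⊕ q ¹) A + E (double k) (- 1ℚ • E 1 (q ¹)) A
    ≡⟨ cong₂ _+_ (E-⊕ (suc (double k)) (E 1 (q ⁰)) (q ¹) A) (E-• (double k) (- 1ℚ) (E 1 (q ¹)) A) ⟩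
  (E (suc (double k)) (E 1 (q ⁰)) A + E (suc (double k)) (q ¹) A) + - 1ℚ * E (double k) (E 1 (q ¹)) A
    ≡⟨ cong₂ (λ x y → (x + E (suc (double k)) (q ¹) A) + - 1ℚ * y) (E-odd-E₁ k (q ⁰) A) (E-even-E₁ k (q ¹) A) ⟩
  (0ℚ + E (suc (double k)) (q ¹) A) + - 1ℚ * E (suc (double k)) (q ¹) A
    ≡⟨ solve 1 (λ x → (con 0ℚ :+ x) :+ con (- 1ℚ) :* x := con 0ℚ) refl (E (suc (double k)) (q ¹) A) ⟩
  0ℚ ∎
E-odd-E₁ {suc n} k q (inside ∷ A) = begin
  s * E (suc (double k)) (- 1ℚ • E 1 (q ¹)) A     ≡⟨ cong (s *_) (E-• (suc (double k)) (- 1ℚ) (E 1 (q ¹)) A) ⟩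
  s * (- 1ℚ * E (suc (double k)) (E 1 (q ¹)) A)   ≡⟨ cong (λ x → s * (- 1ℚ * x)) (E-odd-E₁ k (q ¹) A) ⟩
  s * 0ℚ                                          ≡⟨ ℚ.*-zeroʳ s ⟩
  0ℚ                                              ∎
  where s = -1^ suc (double k)

E-even-E₁ zero q A = refl
E-even-E₁ {zero} (suc k) q A = refl
E-even-E₁ {suc n} (suc k) q (outside ∷ A) = begin
  E (double (suc k)) (E 1 (q ⁰) ⊕ q ¹) A + E (suc (double k)) (- 1ℚ • E 1 (q ¹)) A
    ≡⟨ cong₂ _+_ (E-⊕ (double (suc k)) (E 1 (q ⁰)) (q ¹) A) (E-• (suc (double k)) (- 1ℚ) (E 1 (q ¹)) A) ⟩
  (E (double (suc k)) (E 1 (q ⁰)) A + y) + - 1ℚ * E (suc (double k)) (E 1 (q ¹)) A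
    ≡⟨ cong₂ (λ x z → (x + y) + - 1ℚ * z) (E-even-E₁ (suc k) (q ⁰) A) (E-odd-E₁ k (q ¹) A) ⟩
  (x + y) + - 1ℚ * 0ℚ
    ≡⟨ solve 2 (λ x y → (x :+ y) :+ con (- 1ℚ) :* con 0ℚ := x :+ y) refl x y ⟩
  x + y ∎
  where
  x = E (suc (double (suc k))) (q ⁰) A
  y = E (double (suc k)) (q ¹) A
E-even-E₁ {suc n} (suc k) q (inside ∷ A) = begin
  E (double (suc k)) (E 1 q) (inside ∷ A)           ≡⟨ E-even (suc k) (E 1 q) A ⟩
  E (double (suc k)) (- 1ℚ • E 1 (q ¹)) A           ≡⟨ E-• (double (suc k)) (- 1ℚ) (E 1 (q ¹)) A ⟩
  - 1ℚ * E (double (suc k)) (E 1 (q ¹)) A           ≡⟨ cong (- 1ℚ *_) (E-even-E₁ (suc k) (q ¹) A) ⟩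
  - 1ℚ * E (suc (double (suc k))) (q ¹) A           ≡⟨ E-odd (suc k) q A ⟨
  E (suc (double (suc k))) q (inside ∷ A)           ∎

fromℕ : ℕ → ℚ
fromℕ zero    = 0ℚ
fromℕ (suc k) = 1ℚ + fromℕ k

E₂-in : ∀ {n} (q : R (suc n)) → E 2 q ¹ ≈ E 2 (q ¹)
E₂-in q = E-even 1 q

-- The signs of taking two elements out of a set of size m add up to the Gaussian binomial
-- coefficient of m over 2 at q = -1, which is ⌊m/2⌋. This is k + 1 both for m = 2k + 2 and for m =
-- 2k + 3.
E-even-E₂ : ∀ {n} k (q : R n) → E (double k) (E 2 q) ≈ fromℕ (suc k) • E (double (suc k)) q
E-odd-E₂ : ∀ {n} k (q : R n) →
  E (suc (double k)) (E 2 q) ≈ fromℕ (suc k) • E (suc (double (suc k))) q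

E-even-E₂ zero q A = sym (ℚ.*-identityˡ (E 2 q A))
E-even-E₂ {zero} (suc k) q A = sym (ℚ.*-zeroʳ (fromℕ (suc (suc k))))
E-even-E₂ {suc n} (suc k) q (outside ∷ A) = begin
  E (double (suc k)) (E 2 (q ⁰) ⊕ E 1 (q ¹)) A + E (suc (double k)) (E 2 q ¹) A
    ≡⟨ cong₂ _+_ (E-⊕ (double (suc k)) (E 2 (q ⁰)) (E 1 (q ¹)) A) (E-cong (suc (double k)) (E₂-in q) A) ⟩
  (E (double (suc k)) (E 2 (q ⁰)) A + E (double (suc k)) (E 1 (q ¹)) A) + E (suc (double k)) (E 2 (q ¹)) A
    ≡⟨ cong₂ _+_ (cong₂ _+_ (E-even-E₂ (suc k) (q ⁰) A) (E-even-E₁ (suc k) (q ¹) A)) (E-odd-E₂ k (q ¹) A) ⟩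
  (fromℕ (suc (suc k)) * x + y) + c * y
    ≡⟨ solve 3 (λ c x y → ((con 1ℚ :+ c) :* x :+ y) :+ c :* y := (con 1ℚ :+ c) :* (x :+ y)) refl c x y ⟩
  fromℕ (suc (suc k)) * (x + y) ∎
  where
  c = fromℕ (suc k)
  x = E (double (suc (suc k))) (q ⁰) A
  y = E (suc (double (suc k))) (q ¹) A
E-even-E₂ {suc n} (suc k) q (inside ∷ A) = begin
  E (double (suc k)) (E 2 q) (inside ∷ A)   ≡⟨ E-even (suc k) (E 2 q) A ⟩
  E (double (suc k)) (E 2 q ¹) A            ≡⟨ E-cong (double (suc k)) (E₂-in q) A ⟩
  E (double (suc k)) (E 2 (q ¹)) A          ≡⟨ E-even-E₂ (suc k) (q ¹) A ⟩
  c * E (double (suc (suc k))) (q ¹) A      ≡⟨ cong (c *_) (E-even (suc (suc k)) q A) ⟨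
  c * E (double (suc (suc k))) q (inside ∷ A) ∎
  where c = fromℕ (suc (suc k))

E-odd-E₂ {zero} k q A = sym (ℚ.*-zeroʳ (fromℕ (suc k)))
E-odd-E₂ {suc n} k q (outside ∷ A) = begin
  E (suc (double k)) (E 2 (q ⁰) ⊕ E 1 (q ¹)) A + E (double k) (E 2 q ¹) A
    ≡⟨ cong₂ _+_ (E-⊕ (suc (double k)) (E 2 (q ⁰)) (E 1 (q ¹)) A) (E-cong (double k) (E₂-in q) A) ⟩
  (E (suc (double k)) (E 2 (q ⁰)) A + E (suc (double k)) (E 1 (q ¹)) A) + E (double k) (E 2 (q ¹)) A
    ≡⟨ cong₂ _+_ (cong₂ _+_ (E-odd-E₂ k (q ⁰) A) (E-odd-E₁ k (q ¹) A)) (E-even-E₂ k (q ¹) A) ⟩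
  (c * x + 0ℚ) + c * y
    ≡⟨ solve 3 (λ c x y → (c :* x :+ con 0ℚ) :+ c :* y := c :* (x :+ y)) refl c x y ⟩
  c * (x + y) ∎
  where
  c = fromℕ (suc k)
  x = E (suc (double (suc k))) (q ⁰) A
  y = E (double (suc k)) (q ¹) A
E-odd-E₂ {suc n} k q (inside ∷ A) = begin
  E (suc (double k)) (E 2 q) (inside ∷ A)           ≡⟨ E-odd k (E 2 q) A ⟩
  - 1ℚ * E (suc (double k)) (E 2 q ¹) A             ≡⟨ cong (- 1ℚ *_) (E-cong (suc (double k)) (E₂-in q) A) ⟩
  - 1ℚ * E (suc (double k)) (E 2 (q ¹)) A           ≡⟨ cong (- 1ℚ *_) (E-odd-E₂ k (q ¹) A) ⟩
  - 1ℚ * (c * y)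
    ≡⟨ solve 2 (λ c y → con (- 1ℚ) :* (c :* y) := c :* (con (- 1ℚ) :* y)) refl c y ⟩
  c * (- 1ℚ * y)                                    ≡⟨ cong (c *_) (E-odd (suc k) q A) ⟨
  c * E (suc (double (suc k))) q (inside ∷ A)       ∎
  where
  c = fromℕ (suc k)
  y = E (suc (double (suc k))) (q ¹) A

*-cancel-0 : ∀ c x .{{_ : NonZero c}} → c * x ≡ 0ℚ → x ≡ 0ℚ
*-cancel-0 c x cx≡0 = begin
  x                ≡⟨ ℚ.*-identityˡ x ⟨
  1ℚ * x           ≡⟨ cong (_* x) (ℚ.*-inverseˡ c) ⟨
  (1/ c * c) * x   ≡⟨ ℚ.*-assoc (1/ c) c x ⟩
  1/ c * (c * x)   ≡⟨ cong (1/ c *_) cx≡0 ⟩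
  1/ c * 0ℚ        ≡⟨ ℚ.*-zeroʳ (1/ c) ⟩
  0ℚ               ∎

fromℕ-nonNegative : ∀ k → NonNegative (fromℕ k)
fromℕ-nonNegative zero    = _
fromℕ-nonNegative (suc k) = ℚ.nonNeg+nonNeg⇒nonNeg 1ℚ (fromℕ k) {{fromℕ-nonNegative k}}

fromℕ-nonZero : ∀ k → NonZero (fromℕ (suc k))
fromℕ-nonZero k = ℚ.pos⇒nonZero (fromℕ (suc k))
  {{ℚ.pos+nonNeg⇒pos 1ℚ (fromℕ k) {{fromℕ-nonNegative k}}}}

data Parity : ℕ → Set where
  even : ∀ k → Parity (double k)
  odd  : ∀ k → Parity (suc (double k))

parity : ∀ r → Parity r
parity zero = even 0
parity (suc r) with parity r
... | even k = odd k
... | odd k  = even (suc k)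

-- Odd degrees factor through `E 1`; positive even ones factor through `E 2` up to the invertible
-- constant `fromℕ (suc k)`.
harmonic : ∀ {n} {q : R n} → E 1 q ≈ 𝟎 → E 2 q ≈ 𝟎 → Harmonic q
harmonic {q = q} E₁q≈0 E₂q≈0 r A with parity r
... | even k = trans (sym (E-even-E₁ k q A)) (E-𝟎 (double k) E₁q≈0 A)
... | odd k  = *-cancel-0 (fromℕ (suc k)) (E (double (suc k)) q A) {{fromℕ-nonZero k}}
  (trans (sym (E-even-E₂ k q A)) (E-𝟎 (double k) E₂q≈0 A))

-- Ballot words and the coefficients that determine an element.

-- bal h A: the indicator word of A, preceded by h opening parentheses, is a ballot sequence.
bal : ∀ {n} → ℕ → Subset n → Bool
bal h       []            = true
bal h       (outside ∷ A) = bal (suc h) A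
bal zero    (inside  ∷ A) = false
bal (suc h) (inside  ∷ A) = bal h A

-- The `inside` half of the hypothesis gives `E r (q ¹) = 0` for r > h. The `outside` half then
-- leaves `E r (q ⁰) = 0` for r > h + 1, so `q ⁰` vanishes by induction. With `q ⁰` gone, the same
-- half reads `E (r − 1) (q ¹) = 0` for r > h, one degree more than before.
ballot-determined : ∀ {n} h {q : R n} → (∀ r → h ℕ.< r → E r q ≈ 𝟎) →
                    (∀ A → bal h A ≡ true → q A ≡ 0ℚ) → q ≈ 𝟎
ballot-determined {zero}  h {q} _ vanish [] = vanish [] refl
ballot-determined {suc n} h {q} Eq≈0 vanish = λ { (outside ∷ A) → q⁰≈0 A ; (inside ∷ A) → q¹≈0 A }
  where
  E-in : ∀ r → h ℕ.< suc r → E (suc r) (q ¹) ≈ 𝟎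
  E-in r h<r A = *-cancel-0 (-1^ suc r) _ {{nonZero}} (Eq≈0 (suc r) h<r (inside ∷ A))
    where
    nonZero : NonZero (-1^ suc r)
    nonZero = ≢-nonZero {p = -1^ suc r} λ s≡0 → 1≢0 (trans (sym (-1^-square (suc r))) 
      (trans (cong (_* (-1^ suc r)) s≡0) (ℚ.*-zeroˡ (-1^ suc r))))
      where
      1≢0 : 1ℚ ≢ 0ℚ
      1≢0 ()

  E-out : ∀ r → suc h ℕ.< r → E r (q ⁰) ≈ 𝟎
  E-out (suc (suc r)) (s≤s h<r) A = begin
    E (suc (suc r)) (q ⁰) A          ≡⟨ ℚ.+-identityʳ (E (suc (suc r)) (q ⁰) A) ⟨
    E (suc (suc r)) (q ⁰) A + 0ℚ     ≡⟨ cong (E (suc (suc r)) (q ⁰) A +_) (E-in r h<r A) ⟨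
    E (suc (suc r)) q (outside ∷ A)  ≡⟨ Eq≈0 (suc (suc r)) (ℕ.m<n⇒m<1+n h<r) (outside ∷ A) ⟩
    0ℚ                               ∎
  E-out (suc zero) (s≤s ()) A

  q⁰≈0 : q ⁰ ≈ 𝟎
  q⁰≈0 = ballot-determined (suc h) E-out (vanish ∘ (outside ∷_))

  E-in′ : ∀ r → h ℕ.< suc r → E r (q ¹) ≈ 𝟎
  E-in′ r h<r A = begin
    E r (q ¹) A                            ≡⟨ ℚ.+-identityˡ (E r (q ¹) A) ⟨
    0ℚ + E r (q ¹) A                       ≡⟨ cong (_+ E r (q ¹) A) (E-𝟎 (suc r) q⁰≈0 A) ⟨
    E (suc r) q (outside ∷ A)              ≡⟨ Eq≈0 (suc r) h<r (outside ∷ A) ⟩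
    0ℚ                                     ∎

  q¹-determined : ∀ k → (∀ r → k ℕ.< suc r → E r (q ¹) ≈ 𝟎) →
                  (∀ A → bal k (inside ∷ A) ≡ true → (q ¹) A ≡ 0ℚ) → q ¹ ≈ 𝟎
  -- At `h = 0` the regained degree is 0, and `E 0` is the identity: no ballot coefficient is
  -- consulted.
  q¹-determined zero    E≈0 _       = E≈0 0 (s≤s z≤n)
  q¹-determined (suc k) E≈0 vanish′ = ballot-determined k (λ r k<r → E≈0 r (s≤s k<r)) vanish′

  q¹≈0 : q ¹ ≈ 𝟎
  q¹≈0 = q¹-determined h E-in′ (vanish ∘ (inside ∷_))

-- The inner product

dot-θʳ : ∀ {n} (p : R n) C → ∑ (λ A → p A * θ[ A ] C) ≡ p C
dot-θʳ p []            = ℚ.*-identityʳ (p [])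
dot-θʳ p (outside ∷ C) = trans
  (cong₂ _+_ (dot-θʳ (p ⁰) C) (dot-zeroʳ (p ¹) ≈-refl)) (ℚ.+-identityʳ (p (outside ∷ C)))
dot-θʳ p (inside ∷ C)  = trans
  (cong₂ _+_ (dot-zeroʳ (p ⁰) ≈-refl) (dot-θʳ (p ¹) C)) (ℚ.+-identityˡ (p (inside ∷ C)))

dot-θˡ : ∀ {n} A (q : R n) → ⟪ θ[ A ] , q ⟫ ≡ q A
dot-θˡ []            q = ℚ.*-identityˡ (q [])
dot-θˡ (outside ∷ A) q = trans
  (cong₂ _+_ (dot-θˡ A (q ⁰)) (dot-zeroˡ (q ¹) ≈-refl)) (ℚ.+-identityʳ (q (outside ∷ A)))
dot-θˡ (inside ∷ A)  q = trans
  (cong₂ _+_ (dot-zeroˡ (q ⁰) ≈-refl) (dot-θˡ A (q ¹))) (ℚ.+-identityˡ (q (inside ∷ A)))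

∂-zero-out : ∀ {n} (q : R (suc n)) → ∂ zero q ⁰ ≈ q ¹
∂-zero-out q C = trans (cong₂ _+_
  (dot-zeroʳ (q ⁰) ≈-refl)
  (trans (dot-congʳ (q ¹) λ A → trans
      (cong₂ (λ k B → (-1^ k) * θ[ B ] C) (#below-zero (inside ∷ A)) (p─⊥≡p A))
      (ℚ.*-identityˡ (θ[ A ] C)))
    (dot-θʳ (q ¹) C)))
  (ℚ.+-identityˡ (q (inside ∷ C)))

∂-suc-out : ∀ {n} (i : Fin n) (q : R (suc n)) → ∂ (suc i) q ⁰ ≈ ∂ i (q ⁰)
∂-suc-out i q C = trans (cong₂ _+_
  (dot-congʳ (q ⁰) outside-term) (dot-zeroʳ (q ¹) inside-term))
  (ℚ.+-identityʳ (∂ i (q ⁰) C))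
  where
  outside-term : ∀ A →
    (if does (i ∈? A) then (-1^ #below (suc i) (outside ∷ A)) • θ[ outside ∷ (A - i) ] else 𝟎) (outside ∷ C)
    ≡ (if does (i ∈? A) then (-1^ #below i A) • θ[ A - i ] else 𝟎) C
  outside-term A with does (i ∈? A)
  ... | true  = cong (λ k → (-1^ k) * θ[ A - i ] C) (#below-out i A)
  ... | false = refl
  inside-term : ∀ A →
    (if does (i ∈? A) then (-1^ #below (suc i) (inside ∷ A)) • θ[ inside ∷ (A - i) ] else 𝟎) (outside ∷ C)
    ≡ 0ℚ
  inside-term A with does (i ∈? A)
  ... | true  = ℚ.*-zeroʳ (-1^ #below (suc i) (inside ∷ A))
  ... | false = refl

∂-cong : ∀ {n} (i : Fin n) {p q : R n} → p ≈ q → ∂ i p ≈ ∂ i q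
∂-cong i p≈q C = dot-cong p≈q λ _ → refl

∂-word-suc-out : ∀ {n} w (q : R (suc n)) → ∂-word (map suc w) q ⁰ ≈ ∂-word w (q ⁰)
∂-word-suc-out []      q = ≈-refl
∂-word-suc-out (i ∷ w) q = ≈-trans (∂-suc-out i (∂-word (map suc w) q))
                                    (∂-cong i (∂-word-suc-out w q))

∂-word-cong : ∀ {n} w {p q : R n} → p ≈ q → ∂-word w p ≈ ∂-word w q
∂-word-cong []      p≈q = p≈q
∂-word-cong (i ∷ w) p≈q = ∂-cong i (∂-word-cong w p≈q)

-- In the reversed word the derivative of least index acts first, so each derivative finds its
-- variable in front and no sign arises.
∂-word-elements : ∀ {n} A (q : R n) → ∂-word (reverse (elements A)) q ⊥ ≡ q A
∂-word-elements []            q = refl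
∂-word-elements (outside ∷ A) q = begin
  ∂-word (reverse (map suc (elements A))) q ⊥
    ≡⟨ cong (λ w → ∂-word w q ⊥) (List.reverse-map suc (elements A)) ⟨
  (∂-word (map suc (reverse (elements A))) q ⁰) ⊥    ≡⟨ ∂-word-suc-out (reverse (elements A)) q ⊥ ⟩
  ∂-word (reverse (elements A)) (q ⁰) ⊥              ≡⟨ ∂-word-elements A (q ⁰) ⟩
  q (outside ∷ A)                                    ∎
∂-word-elements (inside ∷ A) q = begin
  ∂-word (reverse (zero ∷ map suc (elements A))) q ⊥
    ≡⟨ cong (λ w → ∂-word w q ⊥) (List.unfold-reverse zero (map suc (elements A))) ⟩
  ∂-word (reverse (map suc (elements A)) ++ zero ∷ []) q ⊥
    ≡⟨ cong (λ p → p ⊥) (List.foldr-++ ∂ q (reverse (map suc (elements A))) (zero ∷ [])) ⟩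
  ∂-word (reverse (map suc (elements A))) (∂ zero q) ⊥
    ≡⟨ cong (λ w → ∂-word w (∂ zero q) ⊥) (List.reverse-map suc (elements A)) ⟨
  (∂-word (map suc (reverse (elements A))) (∂ zero q) ⁰) ⊥
    ≡⟨ ∂-word-suc-out (reverse (elements A)) (∂ zero q) ⊥ ⟩
  ∂-word (reverse (elements A)) (∂ zero q ⁰) ⊥
    ≡⟨ ∂-word-cong (reverse (elements A)) (∂-zero-out q) ⊥ ⟩
  ∂-word (reverse (elements A)) (q ¹) ⊥
    ≡⟨ ∂-word-elements A (q ¹) ⟩
  q (inside ∷ A) ∎

⟨⟩≡dot : ∀ {n} (p q : R n) → ⟨ p , q ⟩ ≡ ⟪ p , q ⟫
⟨⟩≡dot p q = dot-congʳ p λ A → ∂-word-elements A q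

-- Beyond degree `n` there is no subset of the required size, and `F (suc r)` is 0.
F∈I : ∀ {n} r → F (suc r) ∈ I n
F∈I {n} r with suc r ℕ.≤? n
... | yes r<n = generator (s≤s z≤n) r<n
... | no  r≮n = resp (λ A → sym (cong (if_then 1ℚ else 0ℚ)
      (dec-false (∣ A ∣ ℕ.≟ suc r) λ ∣A∣≡1+r → r≮n (subst (ℕ._≤ n) ∣A∣≡1+r (∣p∣≤n A))))) zero

harmonic⇒∈EQH : ∀ {n} {q : R n} → Harmonic q → q ∈ EQH n
harmonic⇒∈EQH {q = q} q-harmonic p p∈I = trans (⟨⟩≡dot p q) (I⊥Harmonic p∈I q-harmonic)

-- The coefficients of `E (suc r) q` are the pairings of `q` with the elements `F (suc r) ⊛ θ[ A ]`
-- of the ideal.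
∈EQH⇒harmonic : ∀ {n} {q : R n} → q ∈ EQH n → Harmonic q
∈EQH⇒harmonic {q = q} q∈EQH r A = begin
  E (suc r) q A                  ≡⟨ dot-θˡ A (E (suc r) q) ⟨
  ⟪ θ[ A ] , E (suc r) q ⟫       ≡⟨ dot-F (suc r) θ[ A ] q ⟨
  ⟪ F (suc r) ⊛ θ[ A ] , q ⟫     ≡⟨ ⟨⟩≡dot (F (suc r) ⊛ θ[ A ]) q ⟨
  ⟨ F (suc r) ⊛ θ[ A ] , q ⟩     ≡⟨ q∈EQH (F (suc r) ⊛ θ[ A ]) (mulʳ θ[ A ] (F∈I r)) ⟩
  0ℚ                             ∎

0≤p*p : ∀ p → 0ℚ ≤ p * p
0≤p*p p with ℚ.≤-total 0ℚ p
... | inj₁ 0≤p = ℚ.nonNegative⁻¹ (p * p) {{ℚ.nonNeg*nonNeg⇒nonNeg p p}}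
  where instance _ = nonNegative 0≤p
... | inj₂ p≤0 = ℚ.nonNegative⁻¹ (p * p) {{ℚ.nonPos*nonPos⇒nonPos p p}}
  where instance _ = nonPositive p≤0

dot-nonNegative : ∀ {n} (p : R n) → 0ℚ ≤ ⟪ p , p ⟫
dot-nonNegative {zero}  p = 0≤p*p (p [])
dot-nonNegative {suc n} p = ℚ.+-mono-≤ (dot-nonNegative (p ⁰)) (dot-nonNegative (p ¹))

dot-definite : ∀ {n} (p : R n) → ⟪ p , p ⟫ ≡ 0ℚ → p ≈ 𝟎
dot-definite {zero} p p²≡0 [] with p [] ℚ.≟ 0ℚ
... | yes p≡0 = p≡0
... | no  p≢0 = *-cancel-0 (p []) (p []) {{≢-nonZero p≢0}} p²≡0
dot-definite {suc n} p p²≡0 = λ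
  { (outside ∷ A) → dot-definite (p ⁰) (first-zero (dot-nonNegative (p ⁰)) (dot-nonNegative (p ¹)) p²≡0) A
  ; (inside  ∷ A) → dot-definite (p ¹) (first-zero (dot-nonNegative (p ¹)) (dot-nonNegative (p ⁰))
                      (trans (ℚ.+-comm ⟪ p ¹ , p ¹ ⟫ ⟪ p ⁰ , p ⁰ ⟫) p²≡0)) A }
  where
  first-zero : ∀ {x y} → 0ℚ ≤ x → 0ℚ ≤ y → x + y ≡ 0ℚ → x ≡ 0ℚ
  first-zero {x} {y} 0≤x 0≤y x+y≡0 = ℚ.≤-antisym
    (subst₂ _≤_ (ℚ.+-identityʳ x) x+y≡0 (ℚ.+-monoʳ-≤ x 0≤y)) 0≤x

-- Gram-Schmidt projection.

-- The last component makes g a linear combination of gs without mentioning coefficients.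
record Projection {n w} (W : R n → Set w) (gs : List (R n)) (v : R n) : Set w where
  field
    g          : R n
    g∈W        : W g
    orthogonal : All (λ u → ⟪ u , v ⊖ g ⟫ ≡ 0ℚ) gs
    spanned    : ∀ x → All (λ u → ⟪ u , x ⟫ ≡ 0ℚ) gs → ⟪ g , x ⟫ ≡ 0ℚ

⊖≈⊕ : ∀ {n} (p q : R n) → p ⊖ q ≈ p ⊕ (- 1ℚ) • q
⊖≈⊕ p q A = solve 2 (λ x y → x :+ :- y := x :+ con (- 1ℚ) :* y) refl (p A) (q A)

dot-⊖ʳ : ∀ {n} (p q s : R n) → ⟪ p , q ⊖ s ⟫ ≡ ⟪ p , q ⟫ + - ⟪ p , s ⟫
dot-⊖ʳ p q s = begin
  ⟪ p , q ⊖ s ⟫                  ≡⟨ dot-congʳ p (⊖≈⊕ q s) ⟩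
  ⟪ p , q ⊕ (- 1ℚ) • s ⟫         ≡⟨ dot-⊕ʳ p q ((- 1ℚ) • s) ⟩
  ⟪ p , q ⟫ + ⟪ p , (- 1ℚ) • s ⟫ ≡⟨ cong (⟪ p , q ⟫ +_) (dot-•ʳ p (- 1ℚ) s) ⟩
  ⟪ p , q ⟫ + - 1ℚ * ⟪ p , s ⟫
    ≡⟨ solve 2 (λ x y → x :+ con (- 1ℚ) :* y := x :+ :- y) refl ⟪ p , q ⟫ ⟪ p , s ⟫ ⟩
  ⟪ p , q ⟫ + - ⟪ p , s ⟫        ∎

dot-⊖ˡ : ∀ {n} (p q s : R n) → ⟪ p ⊖ q , s ⟫ ≡ ⟪ p , s ⟫ + - ⟪ q , s ⟫
dot-⊖ˡ p q s = trans (dot-comm (p ⊖ q) s)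
  (trans (dot-⊖ʳ s p q) (cong₂ (λ x y → x + - y) (dot-comm s p) (dot-comm s q)))

module _ {n w} {W : R n → Set w} (W-resp : ∀ {p q} → p ≈ q → W p → W q) (W-zero : W 𝟎)
         (W-add : ∀ {p q} → W p → W q → W (p ⊕ q))
         (W-scale : ∀ c {p} → W p → W (c • p)) where

  -- The list may be linearly dependent. The residue `u′` of `u` modulo the rest either has norm 0,
  -- hence vanishes and adds no condition, or has an invertible norm and serves as the next
  -- orthogonal direction.
  project : ∀ {gs} → All W gs → ∀ v → Projection W gs v
  project []                        v = record
    { g = 𝟎 ; g∈W = W-zero ; orthogonal = [] ; spanned = λ x _ → dot-zeroˡ x ≈-refl }
  project {u ∷ us} (u∈W ∷ us∈W) v with ⟪ u′ , u′ ⟫ ℚ.≟ 0ℚ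
    where
    u′ = u ⊖ Projection.g (project us∈W u)
  ... | yes u′²≡0 = record
    { g          = V.g
    ; g∈W        = V.g∈W
    ; orthogonal = u⊥ ∷ V.orthogonal
    ; spanned    = λ { x (_ ∷ us⊥x) → V.spanned x us⊥x }
    }
    where
    module P = Projection (project us∈W u)
    module V = Projection (project us∈W v)
    u≈ : u ≈ P.g
    u≈ A = trans (solve 2 (λ x y → x := (x :+ :- y) :+ y) refl (u A) (P.g A))
      (trans (cong (_+ P.g A) (dot-definite (u ⊖ P.g) u′²≡0 A)) (ℚ.+-identityˡ (P.g A)))
    u⊥ : ⟪ u , v ⊖ V.g ⟫ ≡ 0ℚ
    u⊥ = trans (dot-congˡ (v ⊖ V.g) u≈) (P.spanned (v ⊖ V.g) V.orthogonal)
  ... | no u′²≢0 = record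
    { g          = V.g ⊕ c • u′
    ; g∈W        = W-add V.g∈W (W-scale c (W-resp (≈-sym (⊖≈⊕ u P.g)) (W-add u∈W (W-scale (- 1ℚ) P.g∈W))))
    ; orthogonal = u⊥ ∷ All.zipWith (λ {s} → us⊥ s) (V.orthogonal , P.orthogonal)
    ; spanned    = λ { x (u⊥x ∷ us⊥x) → begin
        ⟪ V.g ⊕ c • u′ , x ⟫           ≡⟨ dot-⊕ˡ V.g (c • u′) x ⟩
        ⟪ V.g , x ⟫ + ⟪ c • u′ , x ⟫   ≡⟨ cong₂ _+_ (V.spanned x us⊥x) (dot-•ˡ c u′ x) ⟩
        0ℚ + c * ⟪ u′ , x ⟫            ≡⟨ cong (λ z → 0ℚ + c * z) (trans (dot-⊖ˡ u P.g x)
                                            (cong₂ (λ y z → y + - z) u⊥x (P.spanned x us⊥x))) ⟩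
        0ℚ + c * 0ℚ                    ≡⟨ cong (0ℚ +_) (ℚ.*-zeroʳ c) ⟩
        0ℚ                             ∎ }
    }
    where
    module P = Projection (project us∈W u)
    module V = Projection (project us∈W v)
    u′ v′ : R n
    u′ = u ⊖ P.g
    v′ = v ⊖ V.g
    instance
      nonZero : NonZero ⟪ u′ , u′ ⟫
      nonZero = ≢-nonZero u′²≢0
    -- Chosen to make `v′ ⊖ c • u′` orthogonal to `u′`.
    c = ⟪ u′ , v′ ⟫ * 1/ ⟪ u′ , u′ ⟫
    residue : ∀ s → ⟪ s , v ⊖ (V.g ⊕ c • u′) ⟫ ≡ ⟪ s , v′ ⟫ + - (c * ⟪ s , u′ ⟫)
    residue s = begin
      ⟪ s , v ⊖ (V.g ⊕ c • u′) ⟫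
        ≡⟨ dot-congʳ s (λ A → solve 3 (λ x y z → x :+ :- (y :+ z) := (x :+ :- y) :+ :- z) refl
             (v A) (V.g A) (c * u′ A)) ⟩
      ⟪ s , v′ ⊖ c • u′ ⟫               ≡⟨ dot-⊖ʳ s v′ (c • u′) ⟩
      ⟪ s , v′ ⟫ + - ⟪ s , c • u′ ⟫     ≡⟨ cong (λ z → ⟪ s , v′ ⟫ + - z) (dot-•ʳ s c u′) ⟩
      ⟪ s , v′ ⟫ + - (c * ⟪ s , u′ ⟫)   ∎
    us⊥ : ∀ s → ⟪ s , v′ ⟫ ≡ 0ℚ × ⟪ s , u′ ⟫ ≡ 0ℚ → ⟪ s , v ⊖ (V.g ⊕ c • u′) ⟫ ≡ 0ℚ
    us⊥ s (s⊥v′ , s⊥u′) = begin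
      ⟪ s , v ⊖ (V.g ⊕ c • u′) ⟫        ≡⟨ residue s ⟩
      ⟪ s , v′ ⟫ + - (c * ⟪ s , u′ ⟫)   ≡⟨ cong₂ (λ x y → x + - (c * y)) s⊥v′ s⊥u′ ⟩
      0ℚ + - (c * 0ℚ)                   ≡⟨ solve 1 (λ c → con 0ℚ :+ :- (c :* con 0ℚ) := con 0ℚ) refl c ⟩
      0ℚ                                ∎
    -- Against vectors orthogonal to `P.g`, such as `v′` and `u′`, the element `u` may be replaced
    -- by its residue.
    u-split : ∀ x → ⟪ P.g , x ⟫ ≡ 0ℚ → ⟪ u , x ⟫ ≡ ⟪ u′ , x ⟫
    u-split x Pg⊥x = begin
      ⟪ u , x ⟫                     ≡⟨ solve 1 (λ y → y := y :+ :- con 0ℚ) refl ⟪ u , x ⟫ ⟩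
      ⟪ u , x ⟫ + - 0ℚ              ≡⟨ cong (λ z → ⟪ u , x ⟫ + - z) Pg⊥x ⟨
      ⟪ u , x ⟫ + - ⟪ P.g , x ⟫     ≡⟨ dot-⊖ˡ u P.g x ⟨
      ⟪ u′ , x ⟫                    ∎
    u⊥ : ⟪ u , v ⊖ (V.g ⊕ c • u′) ⟫ ≡ 0ℚ
    u⊥ = begin
      ⟪ u , v ⊖ (V.g ⊕ c • u′) ⟫        ≡⟨ residue u ⟩
      ⟪ u , v′ ⟫ + - (c * ⟪ u , u′ ⟫)   ≡⟨ cong₂ (λ x y → x + - (c * y))
                                             (u-split v′ (P.spanned v′ V.orthogonal))
                                             (u-split u′ (P.spanned u′ P.orthogonal)) ⟩
      ⟪ u′ , v′ ⟫ + - (⟪ u′ , v′ ⟫ * 1/ ⟪ u′ , u′ ⟫ * ⟪ u′ , u′ ⟫)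
        ≡⟨ cong (λ z → ⟪ u′ , v′ ⟫ + - z) (ℚ.*-assoc ⟪ u′ , v′ ⟫ (1/ ⟪ u′ , u′ ⟫) ⟪ u′ , u′ ⟫) ⟩
      ⟪ u′ , v′ ⟫ + - (⟪ u′ , v′ ⟫ * (1/ ⟪ u′ , u′ ⟫ * ⟪ u′ , u′ ⟫))
        ≡⟨ cong (λ z → ⟪ u′ , v′ ⟫ + - (⟪ u′ , v′ ⟫ * z)) (ℚ.*-inverseˡ ⟪ u′ , u′ ⟫) ⟩
      ⟪ u′ , v′ ⟫ + - (⟪ u′ , v′ ⟫ * 1ℚ)
        ≡⟨ solve 1 (λ x → x :+ :- (x :* con 1ℚ) := con 0ℚ) refl ⟪ u′ , v′ ⟫ ⟩
      0ℚ ∎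

-- Linear forms, contractions and their commutation with `E 1` and `E 2`.

infixl 6 _-ᵛ_
infixl 8 _·_

_-ᵛ_ : ∀ {n} → Vec ℚ n → Vec ℚ n → Vec ℚ n
_-ᵛ_ = Vec.zipWith (λ x y → x + - y)

0ᵛ : ∀ {n} → Vec ℚ n
0ᵛ = Vec.replicate _ 0ℚ

_·_ : ∀ {n} → Vec ℚ n → Vec ℚ n → ℚ
[]      · []      = 0ℚ
(c ∷ v) · (d ∷ w) = c * d + v · w

total : ∀ {n} → Vec ℚ n → ℚ
total []      = 0ℚ
total (c ∷ v) = c + total v

e : ∀ {n} → Fin n → Vec ℚ n
e zero    = 1ℚ ∷ 0ᵛ
e (suc i) = 0ℚ ∷ e i

-- Multiplication by the linear form with coefficients v.
wedge : ∀ {n} → Vec ℚ n → R n → R n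
wedge []      q A             = 0ℚ
wedge (c ∷ v) q (outside ∷ A) = wedge v (q ⁰) A
wedge (c ∷ v) q (inside  ∷ A) = c * (q ⁰) A + - 1ℚ * wedge v (q ¹) A

-- The contraction Σ wᵢ ∂ᵢ.
ι : ∀ {n} → Vec ℚ n → R n → R n
ι []      q A             = 0ℚ
ι (d ∷ w) q (outside ∷ A) = ι w (q ⁰) A + d * (q ¹) A
ι (d ∷ w) q (inside  ∷ A) = - 1ℚ * ι w (q ¹) A

-- The covector of the commutator of E 2 with multiplication by v.
B : ∀ {n} → Vec ℚ n → Vec ℚ n
B []      = []
B (c ∷ v) = - total v ∷ Vec.map (c +_) (B v)

wedge-cong : ∀ {n} (v : Vec ℚ n) {p q : R n} → p ≈ q → wedge v p ≈ wedge v q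
wedge-cong []      p≈q A             = refl
wedge-cong (c ∷ v) p≈q (outside ∷ A) = wedge-cong v (p≈q ∘ (outside ∷_)) A
wedge-cong (c ∷ v) p≈q (inside  ∷ A) = cong₂ (λ x y → c * x + - 1ℚ * y)
  (p≈q (outside ∷ A)) (wedge-cong v (p≈q ∘ (inside ∷_)) A)

wedge-⊕ : ∀ {n} (v : Vec ℚ n) (p q : R n) → wedge v (p ⊕ q) ≈ wedge v p ⊕ wedge v q
wedge-⊕ []      p q A             = refl
wedge-⊕ (c ∷ v) p q (outside ∷ A) = wedge-⊕ v (p ⁰) (q ⁰) A
wedge-⊕ (c ∷ v) p q (inside  ∷ A) = trans
  (cong (λ x → c * ((p ⁰) A + (q ⁰) A) + - 1ℚ * x) (wedge-⊕ v (p ¹) (q ¹) A))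
  (solve 5 (λ c a b x y → c :* (a :+ b) :+ con (- 1ℚ) :* (x :+ y)
                       := (c :* a :+ con (- 1ℚ) :* x) :+ (c :* b :+ con (- 1ℚ) :* y)) refl
    c ((p ⁰) A) ((q ⁰) A) (wedge v (p ¹) A) (wedge v (q ¹) A))

wedge-• : ∀ {n} (v : Vec ℚ n) d (q : R n) → wedge v (d • q) ≈ d • wedge v q
wedge-• []      d q A             = sym (ℚ.*-zeroʳ d)
wedge-• (c ∷ v) d q (outside ∷ A) = wedge-• v d (q ⁰) A
wedge-• (c ∷ v) d q (inside  ∷ A) = trans
  (cong (λ x → c * (d * (q ⁰) A) + - 1ℚ * x) (wedge-• v d (q ¹) A))
  (solve 4 (λ c d a x → c :* (d :* a) :+ con (- 1ℚ) :* (d :* x)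
                     := d :* (c :* a :+ con (- 1ℚ) :* x)) refl
    c d ((q ⁰) A) (wedge v (q ¹) A))

wedge-𝟎 : ∀ {n} (v : Vec ℚ n) {q : R n} → q ≈ 𝟎 → wedge v q ≈ 𝟎
wedge-𝟎 []      q≈0 A             = refl
wedge-𝟎 (c ∷ v) q≈0 (outside ∷ A) = wedge-𝟎 v (q≈0 ∘ (outside ∷_)) A
wedge-𝟎 (c ∷ v) q≈0 (inside  ∷ A) = trans
  (cong₂ (λ x y → c * x + - 1ℚ * y) (q≈0 (outside ∷ A)) (wedge-𝟎 v (q≈0 ∘ (inside ∷_)) A))
  (solve 1 (λ c → c :* con 0ℚ :+ con (- 1ℚ) :* con 0ℚ := con 0ℚ) refl c)

wedge-0ᵛ : ∀ {n} (q : R n) → wedge 0ᵛ q ≈ 𝟎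
wedge-0ᵛ q []            = refl
wedge-0ᵛ q (outside ∷ A) = wedge-0ᵛ (q ⁰) A
wedge-0ᵛ q (inside  ∷ A) = trans
  (cong (λ x → 0ℚ * (q ⁰) A + - 1ℚ * x) (wedge-0ᵛ (q ¹) A))
  (solve 1 (λ x → con 0ℚ :* x :+ con (- 1ℚ) :* con 0ℚ := con 0ℚ) refl ((q ⁰) A))

wedge-minus : ∀ {n} (v w : Vec ℚ n) (q : R n) → wedge (v -ᵛ w) q ≈ wedge v q ⊕ - 1ℚ • wedge w q
wedge-minus []      []      q A             = refl
wedge-minus (c ∷ v) (d ∷ w) q (outside ∷ A) = wedge-minus v w (q ⁰) A
wedge-minus (c ∷ v) (d ∷ w) q (inside  ∷ A) = trans
  (cong (λ x → (c + - d) * (q ⁰) A + - 1ℚ * x) (wedge-minus v w (q ¹) A))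
  (solve 5 (λ c d a x y → (c :+ :- d) :* a :+ con (- 1ℚ) :* (x :+ con (- 1ℚ) :* y)
               := (c :* a :+ con (- 1ℚ) :* x) :+ con (- 1ℚ) :* (d :* a :+ con (- 1ℚ) :* y)) refl
    c d ((q ⁰) A) (wedge v (q ¹) A) (wedge w (q ¹) A))

ι-⊕ : ∀ {n} (w : Vec ℚ n) (p q : R n) → ι w (p ⊕ q) ≈ ι w p ⊕ ι w q
ι-⊕ []      p q A             = refl
ι-⊕ (d ∷ w) p q (outside ∷ A) = trans
  (cong (_+ d * ((p ¹) A + (q ¹) A)) (ι-⊕ w (p ⁰) (q ⁰) A))
  (solve 5 (λ d a b x y → (x :+ y) :+ d :* (a :+ b) := (x :+ d :* a) :+ (y :+ d :* b)) refl
    d ((p ¹) A) ((q ¹) A) (ι w (p ⁰) A) (ι w (q ⁰) A))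
ι-⊕ (d ∷ w) p q (inside  ∷ A) = trans (cong (- 1ℚ *_) (ι-⊕ w (p ¹) (q ¹) A))
  (ℚ.*-distribˡ-+ (- 1ℚ) (ι w (p ¹) A) (ι w (q ¹) A))

ι-• : ∀ {n} (w : Vec ℚ n) c (q : R n) → ι w (c • q) ≈ c • ι w q
ι-• []      c q A             = sym (ℚ.*-zeroʳ c)
ι-• (d ∷ w) c q (outside ∷ A) = trans (cong (_+ d * (c * (q ¹) A)) (ι-• w c (q ⁰) A))
  (solve 4 (λ c d a x → c :* x :+ d :* (c :* a) := c :* (x :+ d :* a)) refl
    c d ((q ¹) A) (ι w (q ⁰) A))
ι-• (d ∷ w) c q (inside  ∷ A) = trans (cong (- 1ℚ *_) (ι-• w c (q ¹) A))
  (solve 2 (λ c x → con (- 1ℚ) :* (c :* x) := c :* (con (- 1ℚ) :* x)) refl c (ι w (q ¹) A))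

-- The Clifford relation: a contraction is an odd derivation.
ι-wedge : ∀ {n} (w v : Vec ℚ n) (q : R n) →
          ι w (wedge v q) ≈ w · v • q ⊕ - 1ℚ • wedge v (ι w q)
ι-wedge []      []      q [] = sym (solve 1 (λ x → con 0ℚ :* x :+ con (- 1ℚ) :* con 0ℚ := con 0ℚ) refl (q []))
ι-wedge (d ∷ w) (c ∷ v) q (outside ∷ A) = begin
  ι w (wedge v (q ⁰)) A + d * (c * a + - 1ℚ * y)
    ≡⟨ cong (_+ d * (c * a + - 1ℚ * y)) (ι-wedge w v (q ⁰) A) ⟩
  (w · v * a + - 1ℚ * x) + d * (c * a + - 1ℚ * y)
    ≡⟨ solve 6 (λ c d s a x y → (s :* a :+ con (- 1ℚ) :* x) :+ d :* (c :* a :+ con (- 1ℚ) :* y)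
                            := (d :* c :+ s) :* a :+ con (- 1ℚ) :* (x :+ d :* y)) refl
         c d (w · v) a x y ⟩
  (d * c + w · v) * a + - 1ℚ * (x + d * y)
    ≡⟨ cong (λ z → (d * c + w · v) * a + - 1ℚ * z)
         (trans (wedge-⊕ v (ι w (q ⁰)) (d • q ¹) A) (cong (x +_) (wedge-• v d (q ¹) A))) ⟨
  (d * c + w · v) * a + - 1ℚ * wedge v (ι w (q ⁰) ⊕ d • q ¹) A ∎
  where
  a = (q ⁰) A
  x = wedge v (ι w (q ⁰)) A
  y = wedge v (q ¹) A
ι-wedge (d ∷ w) (c ∷ v) q (inside ∷ A) = begin
  - 1ℚ * ι w (c • q ⁰ ⊕ - 1ℚ • wedge v (q ¹)) A
    ≡⟨ cong (- 1ℚ *_) (trans (ι-⊕ w (c • q ⁰) (- 1ℚ • wedge v (q ¹)) A)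
         (cong₂ _+_ (ι-• w c (q ⁰) A)
           (trans (ι-• w (- 1ℚ) (wedge v (q ¹)) A) (cong (- 1ℚ *_) (ι-wedge w v (q ¹) A))))) ⟩
  - 1ℚ * (c * x + - 1ℚ * (w · v * b + - 1ℚ * y))
    ≡⟨ solve 6 (λ c d s b x y → con (- 1ℚ) :* (c :* x :+ con (- 1ℚ) :* (s :* b :+ con (- 1ℚ) :* y))
         := (d :* c :+ s) :* b :+ con (- 1ℚ) :* (c :* (x :+ d :* b) :+ con (- 1ℚ) :* (con (- 1ℚ) :* y)))
         refl c d (w · v) b x y ⟩
  (d * c + w · v) * b + - 1ℚ * (c * (x + d * b) + - 1ℚ * (- 1ℚ * y))
    ≡⟨ cong (λ z → (d * c + w · v) * b + - 1ℚ * (c * (x + d * b) + - 1ℚ * z))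
         (wedge-• v (- 1ℚ) (ι w (q ¹)) A) ⟨
  (d * c + w · v) * b + - 1ℚ * (c * (x + d * b) + - 1ℚ * wedge v (- 1ℚ • ι w (q ¹)) A) ∎
  where
  b = (q ¹) A
  x = ι w (q ⁰) A
  y = wedge v (ι w (q ¹)) A

-- `E 1` is the contraction by the all-ones covector. Such a shift occurs in the tail of
-- `B (c ∷ v)`.
ι-shift : ∀ {n} c (w : Vec ℚ n) (q : R n) → ι (Vec.map (c +_) w) q ≈ ι w q ⊕ c • E 1 q
ι-shift c []      q []            = sym (trans (ℚ.+-identityˡ (c * 0ℚ)) (ℚ.*-zeroʳ c))
ι-shift c (d ∷ w) q (outside ∷ A) = trans
  (cong (_+ (c + d) * (q ¹) A) (ι-shift c w (q ⁰) A))
  (solve 5 (λ c d b x y → (x :+ c :* y) :+ (c :+ d) :* b := (x :+ d :* b) :+ c :* (y :+ b)) refl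
    c d ((q ¹) A) (ι w (q ⁰) A) (E 1 (q ⁰) A))
ι-shift c (d ∷ w) q (inside  ∷ A) = trans (cong (- 1ℚ *_) (ι-shift c w (q ¹) A))
  (solve 3 (λ c x y → con (- 1ℚ) :* (x :+ c :* y) := con (- 1ℚ) :* x :+ c :* (con (- 1ℚ) :* y)) refl
    c (ι w (q ¹) A) (E 1 (q ¹) A))

-- The Clifford relation for the all-ones covector, whose pairing with `v` is `total v`.
E₁-wedge : ∀ {n} (v : Vec ℚ n) (q : R n) →
           E 1 (wedge v q) ≈ total v • q ⊕ - 1ℚ • wedge v (E 1 q)
E₁-wedge []      q []            = sym (solve 1 (λ x → con 0ℚ :* x :+ con (- 1ℚ) :* con 0ℚ := con 0ℚ) refl (q []))
E₁-wedge (c ∷ v) q (outside ∷ A) = begin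
  E 1 (wedge v (q ⁰)) A + (c * a + - 1ℚ * y)
    ≡⟨ cong (_+ (c * a + - 1ℚ * y)) (E₁-wedge v (q ⁰) A) ⟩
  (total v * a + - 1ℚ * x) + (c * a + - 1ℚ * y)
    ≡⟨ solve 5 (λ c s a x y → (s :* a :+ con (- 1ℚ) :* x) :+ (c :* a :+ con (- 1ℚ) :* y)
                            := (c :+ s) :* a :+ con (- 1ℚ) :* (x :+ y)) refl
         c (total v) a x y ⟩
  (c + total v) * a + - 1ℚ * (x + y)
    ≡⟨ cong (λ z → (c + total v) * a + - 1ℚ * z) (wedge-⊕ v (E 1 (q ⁰)) (q ¹) A) ⟨
  (c + total v) * a + - 1ℚ * wedge v (E 1 (q ⁰) ⊕ q ¹) A ∎
  where
  a = (q ⁰) A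
  x = wedge v (E 1 (q ⁰)) A
  y = wedge v (q ¹) A
E₁-wedge (c ∷ v) q (inside ∷ A) = begin
  - 1ℚ * E 1 (c • q ⁰ ⊕ - 1ℚ • wedge v (q ¹)) A
    ≡⟨ cong (- 1ℚ *_) (trans (E-⊕ 1 (c • q ⁰) (- 1ℚ • wedge v (q ¹)) A)
         (cong₂ _+_ (E-• 1 c (q ⁰) A)
           (trans (E-• 1 (- 1ℚ) (wedge v (q ¹)) A) (cong (- 1ℚ *_) (E₁-wedge v (q ¹) A))))) ⟩
  - 1ℚ * (c * x + - 1ℚ * (total v * b + - 1ℚ * y))
    ≡⟨ solve 5 (λ c s b x y → con (- 1ℚ) :* (c :* x :+ con (- 1ℚ) :* (s :* b :+ con (- 1ℚ) :* y))
         := (c :+ s) :* b :+ con (- 1ℚ) :* (c :* (x :+ b) :+ con (- 1ℚ) :* (con (- 1ℚ) :* y)))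
         refl c (total v) b x y ⟩
  (c + total v) * b + - 1ℚ * (c * (x + b) + - 1ℚ * (- 1ℚ * y))
    ≡⟨ cong (λ z → (c + total v) * b + - 1ℚ * (c * (x + b) + - 1ℚ * z))
         (wedge-• v (- 1ℚ) (E 1 (q ¹)) A) ⟨
  (c + total v) * b + - 1ℚ * (c * (x + b) + - 1ℚ * wedge v (- 1ℚ • E 1 (q ¹)) A) ∎
  where
  b = (q ¹) A
  x = E 1 (q ⁰) A
  y = wedge v (E 1 (q ¹)) A

-- Moving ∂ⱼ∂ᵢ past `v` leaves vᵢ∂ⱼ - vⱼ∂ᵢ. Summed over i < j, the coefficient at position k is the
-- sum of the entries of `v` before k minus the sum of those after k, which is `B v`.
E₂-wedge : ∀ {n} (v : Vec ℚ n) (q : R n) →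
           E 2 (wedge v q) ≈ wedge v (E 2 q) ⊕ ι (B v) q
E₂-wedge []      q []            = refl
E₂-wedge (c ∷ v) q (outside ∷ A) = begin
  E 2 (wedge v (q ⁰)) A + E 1 (c • q ⁰ ⊕ - 1ℚ • wedge v (q ¹)) A
    ≡⟨ cong₂ _+_ (E₂-wedge v (q ⁰) A) (trans (E-⊕ 1 (c • q ⁰) (- 1ℚ • wedge v (q ¹)) A)
         (cong₂ _+_ (E-• 1 c (q ⁰) A)
           (trans (E-• 1 (- 1ℚ) (wedge v (q ¹)) A) (cong (- 1ℚ *_) (E₁-wedge v (q ¹) A))))) ⟩
  (x + z) + (c * u + - 1ℚ * (total v * b + - 1ℚ * y))
    ≡⟨ solve 7 (λ x z c u s b y → (x :+ z) :+ (c :* u :+ con (- 1ℚ) :* (s :* b :+ con (- 1ℚ) :* y))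
         := (x :+ y) :+ ((z :+ c :* u) :+ (:- s) :* b)) refl x z c u (total v) b y ⟩
  (x + y) + ((z + c * u) + - total v * b)
    ≡⟨ cong₂ (λ s t → s + (t + - total v * b))
         (wedge-⊕ v (E 2 (q ⁰)) (E 1 (q ¹)) A) (ι-shift c (B v) (q ⁰) A) ⟨
  wedge v (E 2 (q ⁰) ⊕ E 1 (q ¹)) A + (ι (Vec.map (c +_) (B v)) (q ⁰) A + - total v * b) ∎
  where
  b = (q ¹) A
  x = wedge v (E 2 (q ⁰)) A
  y = wedge v (E 1 (q ¹)) A
  z = ι (B v) (q ⁰) A
  u = E 1 (q ⁰) A
E₂-wedge (c ∷ v) q (inside ∷ A) = begin
  E 2 (wedge (c ∷ v) q) (inside ∷ A)
    ≡⟨ E₂-in (wedge (c ∷ v) q) A ⟩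
  E 2 (c • q ⁰ ⊕ - 1ℚ • wedge v (q ¹)) A
    ≡⟨ trans (E-⊕ 2 (c • q ⁰) (- 1ℚ • wedge v (q ¹)) A)
         (cong₂ _+_ (E-• 2 c (q ⁰) A)
           (trans (E-• 2 (- 1ℚ) (wedge v (q ¹)) A) (cong (- 1ℚ *_) (E₂-wedge v (q ¹) A)))) ⟩
  c * x + - 1ℚ * (y + z)
    ≡⟨ solve 5 (λ c x y z u → c :* x :+ con (- 1ℚ) :* (y :+ z)
         := (c :* (x :+ u) :+ con (- 1ℚ) :* y) :+ con (- 1ℚ) :* (z :+ c :* u)) refl c x y z u ⟩
  (c * (x + u) + - 1ℚ * y) + - 1ℚ * (z + c * u)
    ≡⟨ cong₂ (λ s t → (c * (x + u) + - 1ℚ * s) + - 1ℚ * t)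
         (wedge-cong v (E₂-in q) A) (ι-shift c (B v) (q ¹) A) ⟨
  (c * (x + u) + - 1ℚ * wedge v (E 2 q ¹) A) + - 1ℚ * ι (Vec.map (c +_) (B v)) (q ¹) A ∎
  where
  x = E 2 (q ⁰) A
  y = wedge v (E 2 (q ¹)) A
  z = ι (B v) (q ¹) A
  u = E 1 (q ¹) A

W : ∀ {n} → List (Vec ℚ n) → R n
W = foldr wedge 𝟏

E-𝟏 : ∀ {n} r → E (suc r) (𝟏 {n}) ≈ 𝟎
E-𝟏         r []            = refl
E-𝟏 {suc n} r (outside ∷ A) = cong₂ _+_ (E-𝟏 r A) (E-𝟎 {n} r ≈-refl A)
E-𝟏 {suc n} r (inside  ∷ A) = trans
  (cong ((-1^ suc r) *_) (E-𝟎 {n} (suc r) ≈-refl A)) (ℚ.*-zeroʳ (-1^ suc r))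

ι-𝟎 : ∀ {n} (w : Vec ℚ n) {q : R n} → q ≈ 𝟎 → ι w q ≈ 𝟎
ι-𝟎 []      q≈0 A             = refl
ι-𝟎 (d ∷ w) q≈0 (outside ∷ A) = trans
  (cong₂ (λ x y → x + d * y) (ι-𝟎 w (q≈0 ∘ (outside ∷_)) A) (q≈0 (inside ∷ A)))
  (trans (ℚ.+-identityˡ (d * 0ℚ)) (ℚ.*-zeroʳ d))
ι-𝟎 (d ∷ w) q≈0 (inside  ∷ A) = cong (- 1ℚ *_) (ι-𝟎 w (q≈0 ∘ (inside ∷_)) A)

ι-𝟏 : ∀ {n} (w : Vec ℚ n) → ι w 𝟏 ≈ 𝟎
ι-𝟏 []      A             = refl
ι-𝟏 (d ∷ w) (outside ∷ A) = trans (cong (_+ d * 0ℚ) (ι-𝟏 w A))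
  (trans (ℚ.+-identityˡ (d * 0ℚ)) (ℚ.*-zeroʳ d))
ι-𝟏 (d ∷ w) (inside  ∷ A) = cong (- 1ℚ *_) (ι-𝟎 w ≈-refl A)

ι-W : ∀ {n} (w : Vec ℚ n) {us} → All (λ u → w · u ≡ 0ℚ) us → ι w (W us) ≈ 𝟎
ι-W w                    []             = ι-𝟏 w
ι-W w {us = u ∷ us} (w·u≡0 ∷ w·us≡0) A = begin
  ι w (wedge u (W us)) A                              ≡⟨ ι-wedge w u (W us) A ⟩
  w · u * W us A + - 1ℚ * wedge u (ι w (W us)) A      ≡⟨ cong₂ (λ x y → x * W us A + - 1ℚ * y)
                                                          w·u≡0 (wedge-𝟎 u (ι-W w w·us≡0) A) ⟩
  0ℚ * W us A + - 1ℚ * 0ℚ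
    ≡⟨ solve 1 (λ x → con 0ℚ :* x :+ con (- 1ℚ) :* con 0ℚ := con 0ℚ) refl (W us A) ⟩
  0ℚ                                                  ∎

E₁-W : ∀ {n} {us : List (Vec ℚ n)} → All (λ u → total u ≡ 0ℚ) us → E 1 (W us) ≈ 𝟎
E₁-W {us = []}          []             = E-𝟏 0
E₁-W {us = u ∷ us} (Σu≡0 ∷ Σus≡0) A = begin
  E 1 (wedge u (W us)) A                              ≡⟨ E₁-wedge u (W us) A ⟩
  total u * W us A + - 1ℚ * wedge u (E 1 (W us)) A    ≡⟨ cong₂ (λ x y → x * W us A + - 1ℚ * y)
                                                          Σu≡0 (wedge-𝟎 u (E₁-W Σus≡0) A) ⟩
  0ℚ * W us A + - 1ℚ * 0ℚ
    ≡⟨ solve 1 (λ x → con 0ℚ :* x :+ con (- 1ℚ) :* con 0ℚ := con 0ℚ) refl (W us A) ⟩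
  0ℚ                                                  ∎

-- Moving `E 2` inwards past a factor `u` leaves `ι (B u)` on the factors behind it. As an odd
-- derivation it vanishes on their product once it kills each of them.
E₂-W : ∀ {n} {us : List (Vec ℚ n)} → AllPairs (λ u v → B u · v ≡ 0ℚ) us → E 2 (W us) ≈ 𝟎
E₂-W {us = []}     []          = E-𝟏 1
E₂-W {us = u ∷ us} (Bu·us≡0 ∷ h) A = trans (E₂-wedge u (W us) A)
  (cong₂ _+_ (wedge-𝟎 u (E₂-W h) A) (ι-W (B u) Bu·us≡0 A))

-- The commutator form on unit vectors.

total-minus : ∀ {n} (v w : Vec ℚ n) → total (v -ᵛ w) ≡ total v + - total w
total-minus []      []      = refl
total-minus (c ∷ v) (d ∷ w) = trans (cong (c + - d +_) (total-minus v w))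
  (solve 4 (λ c d x y → (c :+ :- d) :+ (x :+ :- y) := (c :+ x) :+ :- (d :+ y)) refl
    c d (total v) (total w))

total-0ᵛ : ∀ n → total (0ᵛ {n}) ≡ 0ℚ
total-0ᵛ zero    = refl
total-0ᵛ (suc n) = cong (0ℚ +_) (total-0ᵛ n)

total-e : ∀ {n} (i : Fin n) → total (e i) ≡ 1ℚ
total-e {suc n} zero    = cong (1ℚ +_) (total-0ᵛ n)
total-e         (suc i) = cong (0ℚ +_) (total-e i)

·-minusʳ : ∀ {n} (u v w : Vec ℚ n) → u · (v -ᵛ w) ≡ u · v + - (u · w)
·-minusʳ []      []      []      = refl
·-minusʳ (b ∷ u) (c ∷ v) (d ∷ w) = trans (cong (b * (c + - d) +_) (·-minusʳ u v w))
  (solve 5 (λ b c d x y → b :* (c :+ :- d) :+ (x :+ :- y) := (b :* c :+ x) :+ :- (b :* d :+ y)) refl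
    b c d (u · v) (u · w))

·-0ᵛ : ∀ {n} (v : Vec ℚ n) → v · 0ᵛ ≡ 0ℚ
·-0ᵛ []      = refl
·-0ᵛ (c ∷ v) = trans (cong (c * 0ℚ +_) (·-0ᵛ v)) (trans (ℚ.+-identityʳ (c * 0ℚ)) (ℚ.*-zeroʳ c))

-- The recursion of the alternating form Σ_{i<j} (vᵢwⱼ - vⱼwᵢ).
B-∷ : ∀ {n} c (v : Vec ℚ n) d w → B (c ∷ v) · (d ∷ w) ≡ - total v * d + (c * total w + B v · w)
B-∷ c v d w = cong (- total v * d +_) (shift (B v) w)
  where
  shift : ∀ {n} (v w : Vec ℚ n) → Vec.map (c +_) v · w ≡ c * total w + v · w
  shift []      []      = sym (trans (ℚ.+-identityʳ (c * 0ℚ)) (ℚ.*-zeroʳ c))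
  shift (x ∷ v) (y ∷ w) = trans (cong ((c + x) * y +_) (shift v w))
    (solve 5 (λ c x y s t → (c :+ x) :* y :+ (c :* s :+ t) := c :* (y :+ s) :+ (x :* y :+ t)) refl
      c x y (total w) (v · w))

B-minus : ∀ {n} (v w u : Vec ℚ n) → B (v -ᵛ w) · u ≡ B v · u + - (B w · u)
B-minus []      []      []      = refl
B-minus (c ∷ v) (d ∷ w) (b ∷ u) = begin
  B ((c ∷ v) -ᵛ (d ∷ w)) · (b ∷ u)
    ≡⟨ B-∷ (c + - d) (v -ᵛ w) b u ⟩
  - total (v -ᵛ w) * b + ((c + - d) * t + B (v -ᵛ w) · u)
    ≡⟨ cong₂ (λ x y → - x * b + ((c + - d) * t + y)) (total-minus v w) (B-minus v w u) ⟩
  - (total v + - total w) * b + ((c + - d) * t + (B v · u + - (B w · u)))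
    ≡⟨ solve 8 (λ c d b t x y z s → (:- (x :+ :- y)) :* b :+ ((c :+ :- d) :* t :+ (z :+ :- s))
         := ((:- x) :* b :+ (c :* t :+ z)) :+ :- ((:- y) :* b :+ (d :* t :+ s))) refl
         c d b t (total v) (total w) (B v · u) (B w · u) ⟩
  (- total v * b + (c * t + B v · u)) + - (- total w * b + (d * t + B w · u))
    ≡⟨ cong₂ (λ x y → x + - y) (B-∷ c v b u) (B-∷ d w b u) ⟨
  B (c ∷ v) · (b ∷ u) + - (B (d ∷ w) · (b ∷ u)) ∎
  where t = total u

B-0ᵛ : ∀ {n} (w : Vec ℚ n) → B 0ᵛ · w ≡ 0ℚ
B-0ᵛ []      = refl
B-0ᵛ {suc n} (d ∷ w) = begin
  B 0ᵛ · (d ∷ w)                                         ≡⟨ B-∷ 0ℚ 0ᵛ d w ⟩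
  - total (0ᵛ {n}) * d + (0ℚ * total w + B 0ᵛ · w)
    ≡⟨ cong₂ (λ x y → - x * d + (0ℚ * total w + y)) (total-0ᵛ n) (B-0ᵛ w) ⟩
  - 0ℚ * d + (0ℚ * total w + 0ℚ)
    ≡⟨ solve 2 (λ d t → (:- con 0ℚ) :* d :+ (con 0ℚ :* t :+ con 0ℚ) := con 0ℚ) refl d (total w) ⟩
  0ℚ                                                     ∎

B-< : ∀ {n} {i j : Fin n} → i Fin.< j → B (e i) · e j ≡ 1ℚ
B-< {suc n} {zero}  {suc j} _ = begin
  B (e zero) · e (suc j)                                ≡⟨ B-∷ 1ℚ 0ᵛ 0ℚ (e j) ⟩
  - total (0ᵛ {n}) * 0ℚ + (1ℚ * total (e j) + B 0ᵛ · e j) ≡⟨ cong₂ (λ x y → - x * 0ℚ + y) (total-0ᵛ n)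
                                                             (cong₂ (λ x y → 1ℚ * x + y) (total-e j) (B-0ᵛ (e j))) ⟩
  1ℚ                                                    ∎
B-< {suc n} {suc i} {suc j} (s≤s i<j) = begin
  B (e (suc i)) · e (suc j)                               ≡⟨ B-∷ 0ℚ (e i) 0ℚ (e j) ⟩
  - total (e i) * 0ℚ + (0ℚ * total (e j) + B (e i) · e j) ≡⟨ cong₂ (λ x y → - x * 0ℚ + y) (total-e i)
                                                               (cong₂ (λ x y → 0ℚ * x + y) (total-e j) (B-< i<j)) ⟩
  1ℚ                                                      ∎

B-> : ∀ {n} {i j : Fin n} → j Fin.< i → B (e i) · e j ≡ - 1ℚ
B-> {suc n} {suc i} {zero}  _ = begin
  B (e (suc i)) · e zero                                       ≡⟨ B-∷ 0ℚ (e i) 1ℚ 0ᵛ ⟩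
  - total (e i) * 1ℚ + (0ℚ * total (0ᵛ {n}) + B (e i) · 0ᵛ)    ≡⟨ cong₂ (λ x y → - x * 1ℚ + y) (total-e i)
                                                                    (cong₂ (λ x y → 0ℚ * x + y) (total-0ᵛ n) (·-0ᵛ (B (e i)))) ⟩
  - 1ℚ                                                         ∎
B-> {suc n} {suc i} {suc j} (s≤s j<i) = begin
  B (e (suc i)) · e (suc j)                               ≡⟨ B-∷ 0ℚ (e i) 0ℚ (e j) ⟩
  - total (e i) * 0ℚ + (0ℚ * total (e j) + B (e i) · e j) ≡⟨ cong₂ (λ x y → - x * 0ℚ + y) (total-e i)
                                                               (cong₂ (λ x y → 0ℚ * x + y) (total-e j) (B-> j<i)) ⟩
  - 1ℚ                                                    ∎

-- Chords and the non-crossing matching.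

chord : ∀ {n} → Fin n × Fin n → Vec ℚ n
chord (i , j) = e j -ᵛ e i

total-chord : ∀ {n} (c : Fin n × Fin n) → total (chord c) ≡ 0ℚ
total-chord (i , j) = trans (total-minus (e j) (e i)) (cong₂ (λ x y → x + - y) (total-e j) (total-e i))

-- The relation is directed: `c` closes first, so `d` either encloses `c` or lies entirely to its
-- right.
record _⊲_ {n} (c d : Fin n × Fin n) : Set where
  constructor noncrossing
  field
    i<j : proj₁ c Fin.< proj₂ c
    j<l : proj₂ c Fin.< proj₂ d
    k∉[i,j] : proj₁ d Fin.< proj₁ c ⊎ proj₂ c Fin.< proj₁ d

-- At a position outside [i, j] the covectors of `e j` and `e i` have the same sign, so their
-- difference vanishes there. Both ends of `d` are such positions.
B-chord : ∀ {n} {c d : Fin n × Fin n} → c ⊲ d → B (chord c) · chord d ≡ 0ℚ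
B-chord {c = i , j} {k , l} (noncrossing i<j j<l k∉[i,j]) = begin
  B (e j -ᵛ e i) · (e l -ᵛ e k)
    ≡⟨ B-minus (e j) (e i) (e l -ᵛ e k) ⟩
  B (e j) · (e l -ᵛ e k) + - (B (e i) · (e l -ᵛ e k))
    ≡⟨ cong₂ (λ x y → x + - y) (·-minusʳ (B (e j)) (e l) (e k)) (·-minusʳ (B (e i)) (e l) (e k)) ⟩
  (B (e j) · e l + - (B (e j) · e k)) + - (B (e i) · e l + - (B (e i) · e k))
    ≡⟨ cong₂ (λ x y → (x + - (B (e j) · e k)) + - (y + - (B (e i) · e k))) (B-< j<l) (B-< (Fin.<-trans i<j j<l)) ⟩
  (1ℚ + - (B (e j) · e k)) + - (1ℚ + - (B (e i) · e k))
    ≡⟨ cong (λ x → (1ℚ + - x) + - (1ℚ + - (B (e i) · e k))) (same k∉[i,j]) ⟩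
  (1ℚ + - (B (e i) · e k)) + - (1ℚ + - (B (e i) · e k))
    ≡⟨ ℚ.+-inverseʳ (1ℚ + - (B (e i) · e k)) ⟩
  0ℚ ∎
  where
  same : k Fin.< i ⊎ j Fin.< k → B (e j) · e k ≡ B (e i) · e k
  same (inj₁ k<i) = trans (B-> (Fin.<-trans k<i i<j)) (sym (B-> k<i))
  same (inj₂ j<k) = trans (B-< j<k) (sym (B-< (Fin.<-trans i<j j<k)))

-- Two predicates are needed because an opening may come from the stack or from the word, a closing
-- only from the word.
match-All : ∀ {n} {P Q : Pred (Fin n) 0ℓ} st w → All P st → All (P ∘ proj₁) w → All (Q ∘ proj₁) w →
            All (λ (k , l) → P k × Q l) (match st w)
match-All st       []             Pst        Pw        Qw        = []
match-All st       ((j , 0F) ∷ w) Pst        (p ∷ Pw)  (q ∷ Qw)  = match-All (j ∷ st) w (p ∷ Pst) Pw Qw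
match-All []       ((j , 1F) ∷ w) Pst        (p ∷ Pw)  (q ∷ Qw)  = match-All [] w Pst Pw Qw
match-All (i ∷ is) ((j , 1F) ∷ w) (p ∷ Pst)  (_ ∷ Pw)  (q ∷ Qw)  = (p , q) ∷ match-All is w Pst Pw Qw

-- After `i` and `j` are matched, a later pair opens either deeper in the stack, left of `i`, or in
-- the remaining word, right of `j`. The hypotheses are the loop invariant: the stack decreases from
-- its top, the word increases, and the stack lies left of the word.
match-noncrossing : ∀ {n} (st : List (Fin n)) w →
  AllPairs Fin._>_ st → AllPairs (λ x y → proj₁ x Fin.< proj₁ y) w →
  All (λ i → All (λ x → i Fin.< proj₁ x) w) st → AllPairs _⊲_ (match st w)
match-noncrossing st       []             st> w<        st<w = []
match-noncrossing st       ((j , 0F) ∷ w) st> (j<w ∷ w<) st<w =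
  match-noncrossing (j ∷ st) w (All.map All.head st<w ∷ st>) w< (j<w ∷ All.map All.tail st<w)
match-noncrossing []       ((j , 1F) ∷ w) st> (j<w ∷ w<) st<w = match-noncrossing [] w [] w< []
match-noncrossing (i ∷ is) ((j , 1F) ∷ w) (i>is ∷ st>) (j<w ∷ w<) ((i<j ∷ i<w) ∷ st<w) =
  All.map (λ (k∉[i,j] , j<l) → noncrossing i<j j<l k∉[i,j])
    (match-All {P = λ k → k Fin.< i ⊎ j Fin.< k} is w (All.map inj₁ i>is) (All.map inj₂ j<w) j<w)
  ∷ match-noncrossing is w st> w< (All.map All.tail st<w)

zip-All : ∀ {m n} {P : Pred (Fin m) 0ℓ} (f : Fin n → Fin m) (α : Vec (Fin 2) n) → (∀ i → P (f i)) →
          All (P ∘ proj₁) (Vec.toList (Vec.zip (Vec.tabulate f) α))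
zip-All f []      Pf = []
zip-All f (b ∷ α) Pf = Pf zero ∷ zip-All (f ∘ suc) α (Pf ∘ suc)

zip-increasing : ∀ {m n} (f : Fin n → Fin m) (α : Vec (Fin 2) n) → (∀ {i j} → i Fin.< j → f i Fin.< f j) →
  AllPairs (λ x y → proj₁ x Fin.< proj₁ y) (Vec.toList (Vec.zip (Vec.tabulate f) α))
zip-increasing f []      f-mono = []
zip-increasing f (b ∷ α) f-mono =
  zip-All (f ∘ suc) α (λ i → f-mono (s≤s z≤n)) ∷ zip-increasing (f ∘ suc) α (f-mono ∘ s≤s)

C-noncrossing : ∀ {n} (α : Vec (Fin 2) n) → AllPairs _⊲_ (C α)
C-noncrossing α = match-noncrossing [] _ [] (zip-increasing id α id) []

W-chords-harmonic : ∀ {n} {ps : List (Fin n × Fin n)} → AllPairs _⊲_ ps → Harmonic (W (map chord ps))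
W-chords-harmonic {ps = ps} nc = harmonic
  (E₁-W (All.map⁺ (All.universal total-chord ps)))
  (E₂-W (AllPairs.map⁺ (AllPairs.map B-chord nc)))

-- From `Δ` to products of linear forms, and the recursion of `D`.

θ-⊛ : ∀ {n} (i : Fin n) p → θ i ⊛ p ≈ wedge (e i) p
θ-⊛ zero p (outside ∷ A) = trans (⊛-out (θ zero) p A)
  (trans (⊛-zeroˡ (p ⁰) ≈-refl A) (sym (wedge-0ᵛ (p ⁰) A)))
θ-⊛ zero p (inside ∷ A) = begin
  (θ zero ⊛ p) (inside ∷ A)                ≡⟨ ⊛-in (θ zero) p A ⟩
  (𝟏 ⊛ p ⁰) A + (σ 𝟎 ⊛ p ¹) A              ≡⟨ cong₂ _+_ (⊛-identityˡ (p ⁰) A)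
                                                (⊛-zeroˡ (p ¹) (λ B → ℚ.*-zeroʳ (-1^ ∣ B ∣)) A) ⟩
  (p ⁰) A + 0ℚ
    ≡⟨ solve 1 (λ x → x :+ con 0ℚ := con 1ℚ :* x :+ con (- 1ℚ) :* con 0ℚ) refl ((p ⁰) A) ⟩
  1ℚ * (p ⁰) A + - 1ℚ * 0ℚ                 ≡⟨ cong (λ x → 1ℚ * (p ⁰) A + - 1ℚ * x) (wedge-0ᵛ (p ¹) A) ⟨
  1ℚ * (p ⁰) A + - 1ℚ * wedge 0ᵛ (p ¹) A   ∎
θ-⊛ (suc i) p (outside ∷ A) = trans (⊛-out (θ (suc i)) p A) (θ-⊛ i (p ⁰) A)
θ-⊛ (suc i) p (inside ∷ A) = begin
  (θ (suc i) ⊛ p) (inside ∷ A)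
    ≡⟨ ⊛-in (θ (suc i)) p A ⟩
  (𝟎 ⊛ p ⁰) A + (σ (θ i) ⊛ p ¹) A
    ≡⟨ cong₂ _+_ (⊛-zeroˡ (p ⁰) ≈-refl A) (⊛-congˡ (p ¹) (σ-θ i) A) ⟩
  0ℚ + ((- 1ℚ • θ i) ⊛ p ¹) A
    ≡⟨ cong (0ℚ +_) (trans (⊛-•ˡ (- 1ℚ) (θ i) (p ¹) A) (cong (- 1ℚ *_) (θ-⊛ i (p ¹) A))) ⟩
  0ℚ + - 1ℚ * wedge (e i) (p ¹) A
    ≡⟨ cong (_+ - 1ℚ * wedge (e i) (p ¹) A) (ℚ.*-zeroˡ ((p ⁰) A)) ⟨
  0ℚ * (p ⁰) A + - 1ℚ * wedge (e i) (p ¹) A ∎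
  where
  σ-θ : ∀ {n} (i : Fin n) → σ (θ i) ≈ - 1ℚ • θ i
  σ-θ zero    (outside ∷ A) = ℚ.*-zeroʳ (-1^ ∣ A ∣)
  σ-θ zero    (inside ∷ A)  = trans
    (solve 2 (λ s x → (:- s) :* x := con (- 1ℚ) :* (s :* x)) refl (-1^ ∣ A ∣) (𝟏 A))
    (cong (- 1ℚ *_) (σ-𝟏 A))
  σ-θ (suc i) (outside ∷ A) = σ-θ i A
  σ-θ (suc i) (inside ∷ A)  = ℚ.*-zeroʳ (-1^ suc ∣ A ∣)

Δ≈W : ∀ {n} (ps : List (Fin n × Fin n)) → Δ ps ≈ W (map chord ps)
Δ≈W []             = ≈-refl
Δ≈W ((i , j) ∷ ps) A = begin
  ((θ j ⊖ θ i) ⊛ p) A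
    ≡⟨ ⊛-congˡ p (⊖≈⊕ (θ j) (θ i)) A ⟩
  ((θ j ⊕ - 1ℚ • θ i) ⊛ p) A
    ≡⟨ ⊛-⊕ˡ (θ j) (- 1ℚ • θ i) p A ⟩
  (θ j ⊛ p) A + ((- 1ℚ • θ i) ⊛ p) A
    ≡⟨ cong₂ _+_ (θ-⊛ j p A) (trans (⊛-•ˡ (- 1ℚ) (θ i) p A) (cong (- 1ℚ *_) (θ-⊛ i p A))) ⟩
  wedge (e j) p A + - 1ℚ * wedge (e i) p A
    ≡⟨ wedge-minus (e j) (e i) p A ⟨
  wedge (e j -ᵛ e i) p A
    ≡⟨ wedge-cong (e j -ᵛ e i) (Δ≈W ps) A ⟩
  wedge (e j -ᵛ e i) (W (map chord ps)) A ∎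
  where p = Δ ps

Harmonic-resp : ∀ {n} {p q : R n} → p ≈ q → Harmonic p → Harmonic q
Harmonic-resp p≈q hp r A = trans (sym (E-cong (suc r) p≈q A)) (hp r A)

ΔC-harmonic : ∀ {n} (α : ∃ (Ballot {n})) → Harmonic (ΔC α)
ΔC-harmonic (α , _) = Harmonic-resp (≈-sym (Δ≈W (C α))) (W-chords-harmonic (C-noncrossing α))

-- match, with positions replaced by vectors and every matched pair by the difference of its vectors.
factors : ∀ {n} → List (Vec ℚ n) → List (Vec ℚ n × Fin 2) → List (Vec ℚ n)
factors st       []             = []
factors st       ((v , 0F) ∷ w) = factors (v ∷ st) w
factors []       ((v , 1F) ∷ w) = factors [] w
factors (u ∷ st) ((v , 1F) ∷ w) = (v -ᵛ u) ∷ factors st w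

factors-match : ∀ {n} (st : List (Fin n)) w →
  map chord (match st w) ≡ factors (map e st) (map (map₁ e) w)
factors-match st       []             = refl
factors-match st       ((j , 0F) ∷ w) = factors-match (j ∷ st) w
factors-match []       ((j , 1F) ∷ w) = factors-match [] w
factors-match (i ∷ is) ((j , 1F) ∷ w) = cong (e j -ᵛ e i ∷_) (factors-match is w)

-- Matching depends on the letters only, so a substitution in the linear forms commutes with it. It
-- is applied to `Vec.tail`, which sets the first variable to 0, and to `0ℚ ∷_`, which adjoins a new
-- variable.
factors-map : ∀ {m n} (φ : Vec ℚ m → Vec ℚ n) → (∀ u v → φ (u -ᵛ v) ≡ φ u -ᵛ φ v) → ∀ st w →
  map φ (factors st w) ≡ factors (map φ st) (map (map₁ φ) w)
factors-map φ φ-minus st       []             = refl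
factors-map φ φ-minus st       ((v , 0F) ∷ w) = factors-map φ φ-minus (v ∷ st) w
factors-map φ φ-minus []       ((v , 1F) ∷ w) = factors-map φ φ-minus [] w
factors-map φ φ-minus (u ∷ st) ((v , 1F) ∷ w) = cong₂ _∷_ (φ-minus v u) (factors-map φ φ-minus st w)

bit : Bool → Fin 2
bit outside = 0F
bit inside  = 1F

word : ∀ {n} → Subset n → Vec (Fin 2) n
word = Vec.map bit

letters : ∀ {n} → Subset n → List (Vec ℚ n × Fin 2)
letters []      = []
letters (b ∷ α) = (e zero , bit b) ∷ map (map₁ (0ℚ ∷_)) (letters α)

toList-zip-tabulate : ∀ {m n k} (f : Fin m → Fin k) (g : Fin n → Fin m) (α : Vec (Fin 2) n) →
  Vec.toList (Vec.zip (Vec.tabulate (f ∘ g)) α) ≡ map (map₁ f) (Vec.toList (Vec.zip (Vec.tabulate g) α))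
toList-zip-tabulate f g []      = refl
toList-zip-tabulate f g (b ∷ α) = cong ((f (g zero) , b) ∷_) (toList-zip-tabulate f (g ∘ suc) α)

letters-zip : ∀ {n} (α : Subset n) →
  map (map₁ e) (Vec.toList (Vec.zip (Vec.allFin n) (word α))) ≡ letters α
letters-zip []      = refl
letters-zip (b ∷ α) = cong ((e zero , bit b) ∷_) (begin
  map (map₁ e) (Vec.toList (Vec.zip (Vec.tabulate suc) β))
    ≡⟨ cong (map (map₁ e)) (toList-zip-tabulate suc id β) ⟩
  map (map₁ e) (map (map₁ suc) w)
    ≡⟨ List.map-∘ w ⟨
  map (map₁ (0ℚ ∷_) ∘ map₁ e) w
    ≡⟨ List.map-∘ w ⟩
  map (map₁ (0ℚ ∷_)) (map (map₁ e) w)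
    ≡⟨ cong (map (map₁ (0ℚ ∷_))) (letters-zip α) ⟩
  map (map₁ (0ℚ ∷_)) (letters α) ∎)
  where
  β = word α
  w = Vec.toList (Vec.zip (Vec.tabulate id) β)

-- Δ of the word α preceded by h opening parentheses, with the variables of the latter set to 0.
D : ∀ {n} → ℕ → Subset n → R n
D h α = W (factors (List.replicate h 0ᵛ) (letters α))

Δ≈D : ∀ {n} (α : Subset n) → Δ (C (word α)) ≈ D 0 α
Δ≈D α A = trans (Δ≈W (C (word α)) A) (cong (λ us → W us A)
  (trans (factors-match [] (Vec.toList (Vec.zip (Vec.allFin _) (word α))))
         (cong (factors []) (letters-zip α))))

W-tail : ∀ {n} (us : List (Vec ℚ (suc n))) → W us ⁰ ≈ W (map Vec.tail us)
W-tail []             = ≈-refl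
W-tail ((c ∷ u) ∷ us) = wedge-cong u (W-tail us)

tail-minus : ∀ {n} (u v : Vec ℚ (suc n)) → Vec.tail (u -ᵛ v) ≡ Vec.tail u -ᵛ Vec.tail v
tail-minus (c ∷ u) (d ∷ v) = refl

0ᵛ-0ᵛ : ∀ n → 0ᵛ {n} -ᵛ 0ᵛ ≡ 0ᵛ
0ᵛ-0ᵛ zero    = refl
0ᵛ-0ᵛ (suc n) = cong (0ℚ ∷_) (0ᵛ-0ᵛ n)

-- Setting θ₁ to 0 turns the form `e zero` of the first opening parenthesis into `0ᵛ`, one more
-- silent opening on the stack.
D-out : ∀ {n} h (α : Subset n) → D h (outside ∷ α) ⁰ ≈ D (suc h) α
D-out {n} h α A = trans (W-tail (factors (e zero ∷ List.replicate h 0ᵛ) (map (map₁ (0ℚ ∷_)) (letters α))) A)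
  (cong (λ us → W us A) (begin
    map Vec.tail (factors (e zero ∷ List.replicate h 0ᵛ) (map (map₁ (0ℚ ∷_)) (letters α)))
      ≡⟨ factors-map Vec.tail tail-minus (e zero ∷ List.replicate h 0ᵛ) (map (map₁ (0ℚ ∷_)) (letters α)) ⟩
    factors (0ᵛ ∷ map Vec.tail (List.replicate h 0ᵛ)) (map (map₁ Vec.tail) (map (map₁ (0ℚ ∷_)) (letters α)))
      ≡⟨ cong₂ (λ st w → factors (0ᵛ ∷ st) w) (List.map-replicate Vec.tail h (0ᵛ {suc n}))
           (trans (sym (List.map-∘ (letters α))) (List.map-id (letters α))) ⟩
    factors (List.replicate (suc h) 0ᵛ) (letters α) ∎))

-- The first letter closes a silent opening, giving the factor `e zero -ᵛ 0ᵛ`, which is θ₁. The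
-- remaining forms do not involve θ₁.
D-in : ∀ {n} h (α : Subset n) → D (suc h) (inside ∷ α) ⁰ ≈ 𝟎 × D (suc h) (inside ∷ α) ¹ ≈ D h α
D-in {n} h α = outside-part , inside-part
  where
  us : List (Vec ℚ n)
  us = factors (List.replicate h 0ᵛ) (letters α)
  p : R (suc n)
  p = W (map (0ℚ ∷_) us)

  D≡ : D (suc h) (inside ∷ α) ≡ wedge (1ℚ ∷ 0ᵛ) p
  D≡ = cong₂ wedge (cong (1ℚ ∷_) (0ᵛ-0ᵛ n)) (cong W (sym (begin
    map (0ℚ ∷_) us
      ≡⟨ factors-map (0ℚ ∷_) (λ u v → refl) (List.replicate h 0ᵛ) (letters α) ⟩
    factors (map (0ℚ ∷_) (List.replicate h 0ᵛ)) (map (map₁ (0ℚ ∷_)) (letters α))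
      ≡⟨ cong (λ st → factors st (map (map₁ (0ℚ ∷_)) (letters α))) (List.map-replicate (0ℚ ∷_) h 0ᵛ) ⟩
    factors (List.replicate h 0ᵛ) (map (map₁ (0ℚ ∷_)) (letters α)) ∎)))

  p⁰≈ : p ⁰ ≈ W us
  p⁰≈ A = trans (W-tail (map (0ℚ ∷_) us) A)
    (cong (λ vs → W vs A) (trans (sym (List.map-∘ us)) (List.map-id us)))

  outside-part : D (suc h) (inside ∷ α) ⁰ ≈ 𝟎
  outside-part A = trans (cong (λ q → q (outside ∷ A)) D≡) (wedge-0ᵛ (p ⁰) A)

  inside-part : D (suc h) (inside ∷ α) ¹ ≈ D h α
  inside-part A = begin
    D (suc h) (inside ∷ α) (inside ∷ A)        ≡⟨ cong (λ q → q (inside ∷ A)) D≡ ⟩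
    1ℚ * (p ⁰) A + - 1ℚ * wedge 0ᵛ (p ¹) A     ≡⟨ cong₂ (λ x y → 1ℚ * x + - 1ℚ * y) (p⁰≈ A) (wedge-0ᵛ (p ¹) A) ⟩
    1ℚ * W us A + - 1ℚ * 0ℚ
      ≡⟨ solve 1 (λ x → con 1ℚ :* x :+ con (- 1ℚ) :* con 0ℚ := x) refl (W us A) ⟩
    W us A                                     ∎

-- A block triangular system for the ballot coefficients.

comb : ∀ {n} → ℕ → R n → R n
comb h a A = ∑ λ α → a α * D h α A

OnBallots : ∀ {n} → ℕ → R n → Set
OnBallots h a = ∀ α → bal h α ≡ false → a α ≡ 0ℚ

-- Words starting with a closing parenthesis contribute nothing: for `h = 0` their coefficient is 0,
-- otherwise `D` is a multiple of θ₁.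
comb-out : ∀ {n} h (a : R (suc n)) → OnBallots h a → comb h a ⁰ ≈ comb (suc h) (a ⁰)
comb-out h a a-supp A = trans (cong₂ _+_
  (dot-congʳ (a ⁰) λ α → D-out h α A)
  (∑-≈0 (inside-term h a-supp)))
  (ℚ.+-identityʳ (comb (suc h) (a ⁰) A))
  where
  inside-term : ∀ h → OnBallots h a → ∀ α → (a ¹) α * D h (inside ∷ α) (outside ∷ A) ≡ 0ℚ
  inside-term zero    a-supp α = trans (cong (_* D 0 (inside ∷ α) (outside ∷ A)) (a-supp (inside ∷ α) refl))
    (ℚ.*-zeroˡ (D 0 (inside ∷ α) (outside ∷ A)))
  inside-term (suc h) a-supp α = trans (cong ((a ¹) α *_) (proj₁ (D-in h α) A)) (ℚ.*-zeroʳ ((a ¹) α))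

-- The off-diagonal block involves `a ⁰` only. Since `comb-out` settles `a ⁰` beforehand, nothing
-- has to be known about it.
comb-in : ∀ {n} h (a : R (suc n)) A →
  comb (suc h) a (inside ∷ A) ≡ ⟪ a ⁰ , (λ α → D (suc h) (outside ∷ α) (inside ∷ A)) ⟫ + comb h (a ¹) A
comb-in h a A = cong (⟪ a ⁰ , (λ α → D (suc h) (outside ∷ α) (inside ∷ A)) ⟫ +_)
  (dot-congʳ (a ¹) λ α → proj₂ (D-in h α) A)

comb-independent : ∀ {n} h (a : R n) → OnBallots h a → comb h a ≈ 𝟎 → a ≈ 𝟎
comb-independent h a a-supp comb≈0 [] = begin
  a []         ≡⟨ ℚ.*-identityʳ (a []) ⟨
  a [] * 1ℚ    ≡⟨ comb≈0 [] ⟩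
  0ℚ           ∎
comb-independent {suc n} h a a-supp comb≈0 (outside ∷ α) =
  comb-independent (suc h) (a ⁰) (a-supp ∘ (outside ∷_))
    (λ A → trans (sym (comb-out h a a-supp A)) (comb≈0 (outside ∷ A))) α
comb-independent {suc n} zero a a-supp comb≈0 (inside ∷ α) = a-supp (inside ∷ α) refl
comb-independent {suc n} (suc h) a a-supp comb≈0 (inside ∷ α) =
  comb-independent h (a ¹) (a-supp ∘ (inside ∷_)) comb-a¹≈0 α
  where
  a⁰≈0 : a ⁰ ≈ 𝟎
  a⁰≈0 = comb-independent (suc (suc h)) (a ⁰) (a-supp ∘ (outside ∷_))
    (λ A → trans (sym (comb-out (suc h) a a-supp A)) (comb≈0 (outside ∷ A)))
  comb-a¹≈0 : comb h (a ¹) ≈ 𝟎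
  comb-a¹≈0 A = begin
    comb h (a ¹) A
      ≡⟨ ℚ.+-identityˡ (comb h (a ¹) A) ⟨
    0ℚ + comb h (a ¹) A
      ≡⟨ cong (_+ comb h (a ¹) A) (dot-zeroˡ (λ α → D (suc h) (outside ∷ α) (inside ∷ A)) a⁰≈0) ⟨
    ⟪ a ⁰ , (λ α → D (suc h) (outside ∷ α) (inside ∷ A)) ⟫ + comb h (a ¹) A
      ≡⟨ comb-in h a A ⟨
    comb (suc h) a (inside ∷ A)
      ≡⟨ comb≈0 (inside ∷ A) ⟩
    0ℚ ∎

interpolate : ∀ {n} h (v : R n) →
  Σ (R n) λ a → OnBallots h a × (∀ A → bal h A ≡ true → comb h a A ≡ v A)
interpolate {zero}  h v = v , (λ { [] () }) , λ { [] _ → ℚ.*-identityʳ (v []) }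
interpolate {suc n} h v with interpolate (suc h) (v ⁰)
... | a⁰ , a⁰-supp , a⁰-agrees = choose h v a⁰ a⁰-supp a⁰-agrees
  where
  pair : R n → R n → R (suc n)
  pair p q (outside ∷ A) = p A
  pair p q (inside  ∷ A) = q A
  choose : ∀ h (v : R (suc n)) a⁰ → OnBallots (suc h) a⁰ →
    (∀ A → bal (suc h) A ≡ true → comb (suc h) a⁰ A ≡ (v ⁰) A) →
    Σ (R (suc n)) λ a → OnBallots h a × (∀ A → bal h A ≡ true → comb h a A ≡ v A)
  choose zero v a⁰ a⁰-supp a⁰-agrees = a , a-supp ,
    λ { (outside ∷ A) bal-A → trans (comb-out 0 a a-supp A) (a⁰-agrees A bal-A) }
    where
    -- With no parenthesis open, a ballot word cannot start with a closing one.
    a = pair a⁰ 𝟎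
    a-supp : OnBallots 0 a
    a-supp (outside ∷ α) = a⁰-supp α
    a-supp (inside  ∷ α) _ = refl
  choose (suc h) v a⁰ a⁰-supp a⁰-agrees = a , a-supp , agrees
    where
    rest : R n
    rest A = ⟪ a⁰ , (λ α → D (suc h) (outside ∷ α) (inside ∷ A)) ⟫
    -- The values wanted at words starting with a closing parenthesis are corrected by what `a⁰`
    -- already contributes there.
    rec = interpolate h (v ¹ ⊖ rest)
    a = pair a⁰ (proj₁ rec)
    a-supp : OnBallots (suc h) a
    a-supp (outside ∷ α) = a⁰-supp α
    a-supp (inside  ∷ α) = proj₁ (proj₂ rec) α
    agrees : ∀ A → bal (suc h) A ≡ true → comb (suc h) a A ≡ v A
    agrees (outside ∷ A) bal-A = trans (comb-out (suc h) a a-supp A) (a⁰-agrees A bal-A)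
    agrees (inside  ∷ A) bal-A = begin
      comb (suc h) a (inside ∷ A)                  ≡⟨ comb-in h a A ⟩
      rest A + comb h (proj₁ rec) A                ≡⟨ cong (rest A +_) (proj₂ (proj₂ rec) A bal-A) ⟩
      rest A + (v (inside ∷ A) + - rest A)
        ≡⟨ solve 2 (λ x y → x :+ (y :+ :- x) := y) refl (rest A) (v (inside ∷ A)) ⟩
      v (inside ∷ A)                               ∎

-- Ballot sequences as subsets.

support : ∀ {n} → Vec (Fin 2) n → Subset n
support []       = []
support (0F ∷ α) = outside ∷ support α
support (1F ∷ α) = inside ∷ support α

word-support : ∀ {n} (α : Vec (Fin 2) n) → word (support α) ≡ α
word-support []       = refl
word-support (0F ∷ α) = cong (0F ∷_) (word-support α)
word-support (1F ∷ α) = cong (1F ∷_) (word-support α)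

support-injective : ∀ {n} {α β : Vec (Fin 2) n} → support α ≡ support β → α ≡ β
support-injective {α = α} {β} eq = trans (sym (word-support α)) (trans (cong word eq) (word-support β))

-- With `h` openings in advance, s closings among r letters are admissible when s ≤ h + (r - s).
bal⇒partialSum : ∀ {n} h (A : Subset n) → bal h A ≡ true → ∀ r → 2 ℕ.* partialSum r (word A) ℕ.≤ h ℕ.+ r
bal⇒partialSum h       A             _     zero    = z≤n
bal⇒partialSum h       []            _     (suc r) = z≤n
bal⇒partialSum h       (outside ∷ A) bal-A (suc r) =
  subst (2 ℕ.* partialSum r (word A) ℕ.≤_) (sym (ℕ.+-suc h r)) (bal⇒partialSum (suc h) A bal-A r)
bal⇒partialSum (suc h) (inside ∷ A)  bal-A (suc r) = ℕ.≤-Reasoning.begin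
  2 ℕ.* suc (partialSum r (word A))     ℕ.≤-Reasoning.≡⟨ ℕ.*-suc 2 (partialSum r (word A)) ⟩
  2 ℕ.+ 2 ℕ.* partialSum r (word A)     ℕ.≤-Reasoning.≤⟨ ℕ.+-monoʳ-≤ 2 (bal⇒partialSum h A bal-A r) ⟩
  2 ℕ.+ (h ℕ.+ r)                       ℕ.≤-Reasoning.≡⟨ cong suc (ℕ.+-suc h r) ⟨
  suc h ℕ.+ suc r                       ℕ.≤-Reasoning.∎

partialSum⇒bal : ∀ {n} h (A : Subset n) →
  (∀ r → r ℕ.≤ n → 2 ℕ.* partialSum r (word A) ℕ.≤ h ℕ.+ r) → bal h A ≡ true
partialSum⇒bal h       []            _ = refl
partialSum⇒bal h       (outside ∷ A) H = partialSum⇒bal (suc h) A λ r r≤n →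
  subst (2 ℕ.* partialSum r (word A) ℕ.≤_) (ℕ.+-suc h r) (H (suc r) (s≤s r≤n))
partialSum⇒bal zero    (inside ∷ A)  H with s≤s () ← H 1 (s≤s z≤n)
partialSum⇒bal (suc h) (inside ∷ A)  H = partialSum⇒bal h A λ r r≤n → ℕ.+-cancelˡ-≤ 2 _ _
  (subst₂ ℕ._≤_ (ℕ.*-suc 2 (partialSum r (word A))) (cong suc (ℕ.+-suc h r)) (H (suc r) (s≤s r≤n)))

bal⇒Ballot : ∀ {n} (A : Subset n) → bal 0 A ≡ true → Ballot (word A)
bal⇒Ballot A bal-A r _ _ = bal⇒partialSum 0 A bal-A r

Ballot⇒bal : ∀ {n} (α : Vec (Fin 2) n) → Ballot α → bal 0 (support α) ≡ true
Ballot⇒bal α ballot = partialSum⇒bal 0 (support α) λ where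
  zero    _   → z≤n
  (suc r) r<n → subst (λ β → 2 ℕ.* partialSum (suc r) β ℕ.≤ suc r) (sym (word-support α))
                      (ballot (suc r) (s≤s z≤n) r<n)

ΔC≈D : ∀ {n} (α : ∃ (Ballot {n})) → ΔC α ≈ D 0 (support (proj₁ α))
ΔC≈D (α , _) A = trans (cong (λ β → Δ (C β) A) (sym (word-support α))) (Δ≈D (support α) A)

-- Finite linear combinations and independence.

lc : ∀ {n k} → Vector ℚ k → Vector (R n) k → R n
lc {n} = linearCombination (R-module n)

lc-vanish : ∀ {n k} (c : Vector ℚ k) (v : Vector (R n) k) A → (∀ i → v i A ≡ 0ℚ) → lc c v A ≡ 0ℚ
lc-vanish {k = zero}  c v A v≡0 = refl
lc-vanish {k = suc k} c v A v≡0 = trans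
  (cong₂ (λ x y → c zero * x + y) (v≡0 zero) (lc-vanish (c ∘ suc) (v ∘ suc) A (v≡0 ∘ suc)))
  (trans (ℚ.+-identityʳ (c zero * 0ℚ)) (ℚ.*-zeroʳ (c zero)))

lc-cong : ∀ {n k} (c : Vector ℚ k) {v w : Vector (R n) k} → (∀ i → v i ≈ w i) → lc c v ≈ lc c w
lc-cong {k = zero}  c v≈w A = refl
lc-cong {k = suc k} c v≈w A = cong₂ (λ x y → c zero * x + y) (v≈w zero A) (lc-cong (c ∘ suc) (v≈w ∘ suc) A)

Harmonic-𝟎 : ∀ {n} → Harmonic (𝟎 {n})
Harmonic-𝟎 r = E-𝟎 (suc r) ≈-refl

Harmonic-⊕ : ∀ {n} {p q : R n} → Harmonic p → Harmonic q → Harmonic (p ⊕ q)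
Harmonic-⊕ {p = p} {q} hp hq r A = trans (E-⊕ (suc r) p q A) (cong₂ _+_ (hp r A) (hq r A))

Harmonic-• : ∀ {n} c {p : R n} → Harmonic p → Harmonic (c • p)
Harmonic-• c {p} hp r A = trans (E-• (suc r) c p A) (trans (cong (c *_) (hp r A)) (ℚ.*-zeroʳ c))

Harmonic-⊖ : ∀ {n} {p q : R n} → Harmonic p → Harmonic q → Harmonic (p ⊖ q)
Harmonic-⊖ {p = p} {q} hp hq = Harmonic-resp (≈-sym (⊖≈⊕ p q)) (Harmonic-⊕ hp (Harmonic-• (- 1ℚ) hq))

Harmonic-lc : ∀ {n k} (c : Vector ℚ k) {v : Vector (R n) k} → (∀ i → Harmonic (v i)) → Harmonic (lc c v)
Harmonic-lc {n} {zero} c hv = Harmonic-𝟎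
Harmonic-lc {k = suc k} c hv = Harmonic-⊕ (Harmonic-• (c zero) (hv zero)) (Harmonic-lc (c ∘ suc) (hv ∘ suc))

θ-same : ∀ {n} (A : Subset n) → θ[ A ] A ≡ 1ℚ
θ-same A = cong (if_then 1ℚ else 0ℚ) (dec-true (Vec.≡-dec Bool._≟_ A A) refl)

θ-distinct : ∀ {n} {A B : Subset n} → A ≢ B → θ[ A ] B ≡ 0ℚ
θ-distinct {A = A} {B} A≢B = cong (if_then 1ℚ else 0ℚ) (dec-false (Vec.≡-dec Bool._≟_ A B) A≢B)

lc-θ : ∀ {n k} (c : Vector ℚ k) (s : Fin k → Subset n) → Injective _≡_ _≡_ s →
       ∀ j → lc c (θ[_] ∘ s) (s j) ≡ c j
lc-θ {k = suc k} c s s-inj zero = trans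
  (cong₂ (λ x y → c zero * x + y) (θ-same (s zero))
    (lc-vanish (c ∘ suc) (θ[_] ∘ s ∘ suc) (s zero) λ i → θ-distinct λ eq → Fin.0≢1+n (sym (s-inj eq))))
  (trans (ℚ.+-identityʳ (c zero * 1ℚ)) (ℚ.*-identityʳ (c zero)))
lc-θ {k = suc k} c s s-inj (suc j) = trans
  (cong₂ (λ x y → c zero * x + y) (θ-distinct λ eq → Fin.0≢1+n (s-inj eq))
    (lc-θ (c ∘ suc) (s ∘ suc) (λ eq → Fin.suc-injective (s-inj eq)) j))
  (trans (cong (_+ c (suc j)) (ℚ.*-zeroʳ (c zero))) (ℚ.+-identityˡ (c (suc j))))

-- Translates a combination over an indexed family into a coefficient function on subsets, the form
-- in which the triangular system is stated.
comb-lc-θ : ∀ {n k} (c : Vector ℚ k) (s : Fin k → Subset n) → comb 0 (lc c (θ[_] ∘ s)) ≈ lc c (D 0 ∘ s)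
comb-lc-θ {n} {zero}  c s A = dot-zeroˡ (λ α → D 0 α A) (≈-refl {n} {𝟎})
comb-lc-θ {n} {suc k} c s A = begin
  ⟪ c zero • θ[ s zero ] ⊕ lc (c ∘ suc) (θ[_] ∘ s ∘ suc) , D∙A ⟫
    ≡⟨ dot-⊕ˡ (c zero • θ[ s zero ]) (lc (c ∘ suc) (θ[_] ∘ s ∘ suc)) D∙A ⟩
  ⟪ c zero • θ[ s zero ] , D∙A ⟫ + comb 0 (lc (c ∘ suc) (θ[_] ∘ s ∘ suc)) A
    ≡⟨ cong₂ _+_ (trans (dot-•ˡ (c zero) θ[ s zero ] D∙A) (cong (c zero *_) (dot-θˡ (s zero) D∙A)))
                 (comb-lc-θ (c ∘ suc) (s ∘ suc) A) ⟩
  c zero * D 0 (s zero) A + lc (c ∘ suc) (D 0 ∘ s ∘ suc) A ∎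
  where
  D∙A : R n
  D∙A α = D 0 α A

ΔC-independent : ∀ {n k} (x : Fin k → ∃ (Ballot {n})) → Injective _≡_ (λ α β → ΔC α ≈ ΔC β) x →
                 ∀ (c : Vector ℚ k) → lc c (ΔC ∘ x) ≈ 𝟎 → ∀ i → c i ≡ 0ℚ
ΔC-independent {n} {k} x x-inj c lc≈0 i = begin
  c i                       ≡⟨ lc-θ c s s-injective i ⟨
  lc c (θ[_] ∘ s) (s i)     ≡⟨ comb-independent 0 (lc c (θ[_] ∘ s)) on-ballots comb≈0 (s i) ⟩
  0ℚ                        ∎
  where
  s : Fin k → Subset n
  s = support ∘ proj₁ ∘ x
  s-injective : Injective _≡_ _≡_ s
  -- The family is injective into the set of elements Δ; equal words have equal Δ, so the words are
  -- distinct as well.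
  s-injective eq = x-inj λ A → cong (λ α → Δ (C α) A) (support-injective eq)
  comb≈0 : comb 0 (lc c (θ[_] ∘ s)) ≈ 𝟎
  comb≈0 A = trans (comb-lc-θ c s A) (trans (lc-cong c (λ j → ≈-sym (ΔC≈D (x j))) A) (lc≈0 A))
  on-ballots : OnBallots 0 (lc c (θ[_] ∘ s))
  on-ballots α bal-α = lc-vanish c (θ[_] ∘ s) α λ j → θ-distinct {A = s j} {α} λ sj≡α →
    contradiction (trans (sym (Ballot⇒bal (proj₁ (x j)) (proj₂ (x j)))) (trans (cong (bal 0) sj≡α) bal-α)) λ ()

-- Spanning.

subsets : ∀ n → List (Subset n)
subsets zero    = [] ∷ []
subsets (suc n) = map (outside ∷_) (subsets n) ++ map (inside ∷_) (subsets n)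

sumˡ : List ℚ → ℚ
sumˡ = foldr _+_ 0ℚ

sumˡ-++ : ∀ xs ys → sumˡ (xs ++ ys) ≡ sumˡ xs + sumˡ ys
sumˡ-++ []       ys = sym (ℚ.+-identityˡ (sumˡ ys))
sumˡ-++ (x ∷ xs) ys = trans (cong (x +_) (sumˡ-++ xs ys)) (sym (ℚ.+-assoc x (sumˡ xs) (sumˡ ys)))

-- With `lc-lookup`, this turns a sum over all subsets into a combination indexed by `Fin k`, as
-- `IsBasisOf` requires.
∑-subsets : ∀ {n} (f : R n) → ∑ f ≡ sumˡ (map f (subsets n))
∑-subsets {zero}  f = sym (ℚ.+-identityʳ (f []))
∑-subsets {suc n} f = begin
  ∑ (f ⁰) + ∑ (f ¹)
    ≡⟨ cong₂ _+_ (∑-subsets (f ⁰)) (∑-subsets (f ¹)) ⟩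
  sumˡ (map (f ⁰) (subsets n)) + sumˡ (map (f ¹) (subsets n))
    ≡⟨ cong₂ (λ xs ys → sumˡ xs + sumˡ ys) (List.map-∘ (subsets n)) (List.map-∘ (subsets n)) ⟩
  sumˡ (map f l) + sumˡ (map f r)
    ≡⟨ sumˡ-++ (map f l) (map f r) ⟨
  sumˡ (map f l ++ map f r)
    ≡⟨ cong sumˡ (List.map-++ f l r) ⟨
  sumˡ (map f (l ++ r)) ∎
  where
  l = map (outside ∷_) (subsets n)
  r = map (inside ∷_) (subsets n)

All-subsets : ∀ {p n} {P : Subset n → Set p} → All P (subsets n) → ∀ A → P A
All-subsets {n = zero}  (p ∷ []) []            = p
All-subsets {n = suc n} ps       (outside ∷ A) =
  All-subsets (All.map⁻ (All.++⁻ˡ (map (outside ∷_) (subsets n)) ps)) A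
All-subsets {n = suc n} ps       (inside ∷ A)  =
  All-subsets (All.map⁻ (All.++⁻ʳ (map (outside ∷_) (subsets n)) ps)) A

lc-lookup : ∀ {n} {X : Set} (c : X → ℚ) (v : X → R n) xs A →
            lc (c ∘ lookup xs) (v ∘ lookup xs) A ≡ sumˡ (map (λ x → c x * v x A) xs)
lc-lookup c v []       A = refl
lc-lookup c v (x ∷ xs) A = cong (c x * v x A +_) (lc-lookup c v xs A)

bal-⊥ : ∀ n h → bal h (⊥ {n}) ≡ true
bal-⊥ zero    h = refl
bal-⊥ (suc n) h = bal-⊥ n (suc h)

-- Sets that are not ballot are sent to the ballot sequence 0…0, as a junk value.
ballot-word : ∀ {n} (α : Subset n) → Σ (∃ (Ballot {n})) λ β → bal 0 α ≡ true → proj₁ β ≡ word α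
ballot-word {n} α with bal 0 α in eq
... | true  = (word α , bal⇒Ballot α eq) , λ _ → refl
... | false = (word ⊥ , bal⇒Ballot (⊥ {n}) (bal-⊥ n 0)) , λ ()

ballot : ∀ {n} → Subset n → ∃ (Ballot {n})
ballot = proj₁ ∘ ballot-word

-- The junk value is harmless: where it is used, the coefficient is 0.
ΔC-ballot : ∀ {n} (a : R n) → OnBallots 0 a → ∀ α A → a α * D 0 α A ≡ a α * ΔC (ballot α) A
ΔC-ballot a a-supp α A = by-cases (bal 0 α) refl
  where
  by-cases : ∀ b → bal 0 α ≡ b → a α * D 0 α A ≡ a α * ΔC (ballot α) A
  by-cases true  bal-α = cong (a α *_) (trans (sym (Δ≈D α A))
    (cong (λ β → Δ (C β) A) (sym (proj₂ (ballot-word α) bal-α))))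
  by-cases false bal-α = trans (cong (_* D 0 α A) (a-supp α bal-α)) (trans (ℚ.*-zeroˡ (D 0 α A))
    (sym (trans (cong (_* ΔC (ballot α) A) (a-supp α bal-α)) (ℚ.*-zeroˡ (ΔC (ballot α) A)))))

-- The difference of `v` and its interpolant is harmonic and vanishes at all ballot words, so
-- `ballot-determined` at `h = 0` applies.
harmonic-spanned : ∀ {n} {v : R n} → Harmonic v →
  ∃ λ k → Σ (Fin k → ∃ (Ballot {n})) λ x → Σ (Vector ℚ k) λ c → v ≈ lc c (ΔC ∘ x)
harmonic-spanned {n} {v} v-harmonic =
  length (subsets n) , ballot ∘ lookup (subsets n) , a ∘ lookup (subsets n) , λ A → trans (v≈comb A) (comb≈lc A)
  where
  a : R n
  a = proj₁ (interpolate 0 v)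
  a-supp : OnBallots 0 a
  a-supp = proj₁ (proj₂ (interpolate 0 v))
  comb≈lc : comb 0 a ≈ lc (a ∘ lookup (subsets n)) (ΔC ∘ ballot ∘ lookup (subsets n))
  comb≈lc A = begin
    ∑ (λ α → a α * D 0 α A)              ≡⟨ ∑-cong (λ α → ΔC-ballot a a-supp α A) ⟩
    ∑ (λ α → a α * ΔC (ballot α) A)      ≡⟨ ∑-subsets (λ α → a α * ΔC (ballot α) A) ⟩
    sumˡ (map (λ α → a α * ΔC (ballot α) A) (subsets n)) ≡⟨ lc-lookup a (ΔC ∘ ballot) (subsets n) A ⟨
    lc (a ∘ lookup (subsets n)) (ΔC ∘ ballot ∘ lookup (subsets n)) A ∎
  comb-harmonic : Harmonic (comb 0 a)
  comb-harmonic = Harmonic-resp (≈-sym comb≈lc)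
    (Harmonic-lc (a ∘ lookup (subsets n)) (λ i → ΔC-harmonic (ballot (lookup (subsets n) i))))
  difference≈0 : v ⊖ comb 0 a ≈ 𝟎
  difference≈0 = ballot-determined 0
    (λ { (suc r) _ → Harmonic-⊖ v-harmonic comb-harmonic r })
    (λ A bal-A → trans (cong (λ x → v A + - x) (proj₂ (proj₂ (interpolate 0 v)) A bal-A)) (ℚ.+-inverseʳ (v A)))
  v≈comb : v ≈ comb 0 a
  v≈comb A = begin
    v A                              ≡⟨ solve 2 (λ x y → x := (x :+ :- y) :+ y) refl (v A) (comb 0 a A) ⟩
    (v A + - comb 0 a A) + comb 0 a A ≡⟨ cong (_+ comb 0 a A) (difference≈0 A) ⟩
    0ℚ + comb 0 a A                  ≡⟨ ℚ.+-identityˡ (comb 0 a A) ⟩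
    comb 0 a A                       ∎

decompose : ∀ {n} (v : R n) → Σ (R n) λ g → g ∈ I n × Harmonic (v ⊖ g)
decompose {n} v = g , g∈W , harmonic (killed 0 (All.++⁻ˡ (multiples 0) orthogonal))
                                     (killed 1 (All.++⁻ʳ (multiples 0) orthogonal))
  where
  -- Orthogonality to the multiples of `F 1` and `F 2` is enough, since `E 1` and `E 2` decide
  -- harmonicity; finitely many suffice because the monomials span.
  multiples : ℕ → List (R n)
  multiples r = map (λ A → F (suc r) ⊛ θ[ A ]) (subsets n)
  multiples∈I : ∀ r → All (_∈ I n) (multiples r)
  multiples∈I r = All.map⁺ (All.universal (λ A → mulʳ θ[ A ] (F∈I r)) (subsets n))
  open Projection (project {W = I n} resp zero add scale
                     (All.++⁺ (multiples∈I 0) (multiples∈I 1)) v)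
  killed : ∀ r → All (λ u → ⟪ u , v ⊖ g ⟫ ≡ 0ℚ) (multiples r) → E (suc r) (v ⊖ g) ≈ 𝟎
  killed r orth A = begin
    E (suc r) (v ⊖ g) A               ≡⟨ dot-θˡ A (E (suc r) (v ⊖ g)) ⟨
    ⟪ θ[ A ] , E (suc r) (v ⊖ g) ⟫    ≡⟨ dot-F (suc r) θ[ A ] (v ⊖ g) ⟨
    ⟪ F (suc r) ⊛ θ[ A ] , v ⊖ g ⟫    ≡⟨ All-subsets (All.map⁻ orth) A ⟩
    0ℚ                                ∎

-- Such an element is orthogonal to itself.
I∩Harmonic : ∀ {n} {p : R n} → p ∈ I n → Harmonic p → p ≈ 𝟎
I∩Harmonic {p = p} p∈I p-harmonic = dot-definite p (I⊥Harmonic p∈I p-harmonic)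

basis-EQH : ∀ n → IsBasisOf (R-module n) (EQH n) (𝒟 n) ΔC
basis-EQH n = record
  { contained   = λ α → harmonic⇒∈EQH (ΔC-harmonic α)
  ; independent = ΔC-independent
  ; spanning    = λ v v∈EQH → harmonic-spanned (∈EQH⇒harmonic v∈EQH)
  }

ΔC-spans-mod-I : ∀ {n} (v : R n) →
  ∃ λ k → Σ (Fin k → ∃ (Ballot {n})) λ x → Σ (Vector ℚ k) λ c → v ≈ lc c (ΔC ∘ x) [mod-I]
ΔC-spans-mod-I {n} v = reduce (decompose v)
  where
  reduce : (Σ (R n) λ g → g ∈ I n × Harmonic (v ⊖ g)) →
    ∃ λ k → Σ (Fin k → ∃ (Ballot {n})) λ x → Σ (Vector ℚ k) λ c → v ≈ lc c (ΔC ∘ x) [mod-I]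
  reduce (g , g∈I , v-g-harmonic) =
    let k , x , c , v-g≈lc = harmonic-spanned v-g-harmonic
    in k , x , c , resp (λ A → begin
      g A                           ≡⟨ solve 2 (λ x y → y := x :+ :- (x :+ :- y)) refl (v A) (g A) ⟩
      v A + - (v A + - g A)         ≡⟨ cong (λ y → v A + - y) (v-g≈lc A) ⟩
      v A + - lc c (ΔC ∘ x) A       ∎) g∈I

-- A combination of the Δ is harmonic, so a relation modulo the ideal is already a relation in
-- `R n`.
ΔC-independent-mod-I : ∀ {n k} (x : Fin k → ∃ (Ballot {n})) → Injective _≡_ (λ α β → ΔC α ≈ ΔC β) x →
                       ∀ (c : Vector ℚ k) → lc c (ΔC ∘ x) ≈ 𝟎 [mod-I] → ∀ i → c i ≡ 0ℚ
ΔC-independent-mod-I x x-inj c lc∈I = ΔC-independent x x-inj c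
  (I∩Harmonic (resp (λ A → ℚ.+-identityʳ (lc c (ΔC ∘ x) A)) lc∈I) (Harmonic-lc c (ΔC-harmonic ∘ x)))

basis-EQC : ∀ n → IsBasisOf (EQC n) U (𝒟 n) ΔC
basis-EQC n = record
  { contained   = λ α → tt
  ; independent = ΔC-independent-mod-I
  ; spanning    = λ v _ → ΔC-spans-mod-I v
  }

corollary4p5 : ∀ (n : ℕ) → n ≥ 1 →
    IsBasisOf (R-module n) (EQH n) (𝒟 n) ΔC × IsBasisOf (EQC n) U (𝒟 n) ΔC
corollary4p5 n _ = basis-EQH n , basis-EQC n
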